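{- Let $G$ be an infinitely edge-connected graph, let $u,v$ be two distinct vertices of $G$, and let $C$ be a component of $G-u-v$ such that both $u$ and $v$ have a neighbour in $C$. Then at least one of the following holds: (i) $G[V(C)\cup\{u,v\}]$ contains a $T_{\aleph_0}*t$ minor; (ii) $G[V(C)\cup\{u,v\}]$ contains a football minor connecting $u$ and $v$.
   Context: Graphs are simple and may be infinite. A graph is infinitely edge-connected if no two distinct vertices can be separated by deleting finitely many edges. $H$ is a minor of $G$ if there are disjoint non-empty vertex sets $V_h\subseteq V(G)$ (branch sets, $h\in V(H)$), each inducing a connected subgraph, with a $V_h$–$V_{h'}$ edge whenever $hh'\in E(H)$. $T_{\aleph_0}$ is the tree with every vertex of countably infinite degree; $T_{\aleph_0}*t$ is obtained by adding a vertex $t$ adjacent to all its vertices. A football with endvertices $u',v'$ is an infinitely edge-connected graph containing $u',v'$ such that deleting $u'$ and $v'$ leaves an infinitely edge-connected graph. A football minor connecting $x$ and $y$ is a football minor with endvertices $u',v'$ such that the branch set of $u'$ contains $x$ and that of $v'$ contains $y$, or vice versa. -}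

module Defs where

open import Level using (Level; _⊔_; 0ℓ) renaming (suc to lsuc)
open import Data.Nat using (ℕ)
open import Data.List using (List; _∷_)
open import Data.List.Membership.Propositional using (_∈_)
open import Data.Maybe using (Maybe; just; nothing)
open import Data.Product using (Σ; ∃; _×_; _,_)
open import Data.Sum using (_⊎_; inj₁; inj₂)
open import Data.Unit.Polymorphic using (⊤)
open import Relation.Nullary using (¬_)
open import Data.Empty using (⊥)
import Data.Unit as U
open import Relation.Binary.PropositionalEquality using (_≡_; _≢_; refl)

record Graph (ℓ : Level) : Set (lsuc ℓ) where
  field
    V      : Set ℓ
    _~_    : V → V → Set ℓ
    ~-sym  : ∀ {x y} → x ~ y → y ~ x
    ~-irr  : ∀ {x} → ¬ (x ~ x)
open Graph public

data Walk {a r} {A : Set a} (R : A → A → Set r) : A → A → Set (a ⊔ r) where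
  here  : ∀ {x} → Walk R x x
  step  : ∀ {x y z} → R x y → Walk R y z → Walk R x z

module _ {ℓ} (G : Graph ℓ) where

  StepAvoiding : (S : V G → Set ℓ) (F : List (V G × V G)) → V G → V G → Set ℓ
  StepAvoiding S F x y =
    _~_ G x y × S y × ¬ ((x , y) ∈ F) × ¬ ((y , x) ∈ F)

  -- walk in the induced subgraph G[S] (start vertex in S as well)
  StepIn : (V G → Set ℓ) → V G → V G → Set ℓ
  StepIn S x y = _~_ G x y × S y

  InfEdgeConnectedOn : (V G → Set ℓ) → Set ℓ
  InfEdgeConnectedOn S =
    ∀ x y → S x → S y → (F : List (V G × V G)) → Walk (StepAvoiding S F) x y

  InfEdgeConnected : Set ℓ
  InfEdgeConnected = InfEdgeConnectedOn (λ _ → ⊤)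

Football : ∀ {ℓ} (H : Graph ℓ) → V H → V H → Set ℓ
Football H u' v' =
  u' ≢ v' × InfEdgeConnected H
          × InfEdgeConnectedOn H (λ x → x ≢ u' × x ≢ v')

record MinorModel {ℓ ℓ'} (G : Graph ℓ) (S : V G → Set ℓ) (H : Graph ℓ') :
       Set (ℓ ⊔ lsuc ℓ ⊔ ℓ') where
  field
    B          : V H → V G → Set ℓ
    B⊆S        : ∀ h x → B h x → S x
    disjoint   : ∀ h h' x → B h x → B h' x → h ≡ h'
    nonempty   : ∀ h → ∃ λ x → B h x
    connected  : ∀ h x y → B h x → B h y → Walk (StepIn G (B h)) x y
    edges      : ∀ h h' → _~_ H h h' →
                 ∃ λ x → ∃ λ y → B h x × B h' y × _~_ G x y

-- T_ℵ₀ : vertices are finite sequences of naturals, s is adjacent to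
-- n ∷ s; every vertex has countably infinite degree.
-- T_ℵ₀ * t : add the vertex t = nothing adjacent to everything.

data Child : List ℕ → List ℕ → Set where
  child : ∀ n s → Child s (n ∷ s)

TAdj : List ℕ → List ℕ → Set
TAdj s t = Child s t ⊎ Child t s

TAdj-irr : ∀ {s} → ¬ TAdj s s
TAdj-irr (inj₁ ())
TAdj-irr (inj₂ ())

TstarAdj : Maybe (List ℕ) → Maybe (List ℕ) → Set
TstarAdj nothing  nothing  = ⊥
TstarAdj nothing  (just _) = U.⊤
TstarAdj (just _) nothing  = U.⊤
TstarAdj (just s) (just t) = TAdj s t

TstarAdj-sym : ∀ {x y} → TstarAdj x y → TstarAdj y x
TstarAdj-sym {nothing} {just _} _ = _
TstarAdj-sym {just _} {nothing} _ = _
TstarAdj-sym {just _} {just _} (inj₁ c) = inj₂ c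
TstarAdj-sym {just _} {just _} (inj₂ c) = inj₁ c

TstarAdj-irr : ∀ {x} → ¬ TstarAdj x x
TstarAdj-irr {nothing} ()
TstarAdj-irr {just s} a = TAdj-irr a

TℵStar : Graph 0ℓ
TℵStar = record
  { V = Maybe (List ℕ) ; _~_ = TstarAdj
  ; ~-sym = TstarAdj-sym ; ~-irr = TstarAdj-irr }

{-# OPTIONS --safe #-}
module Submission where

-- A state (U, W, R) consists of disjoint connected sets such that R is attached to U and
-- to W and no vertex of R is separated from U ∪ W by finitely many edges; the theorem
-- starts from ({u}, {v}, C).  Call vertices of R equivalent if finitely many edges of R
-- do not separate them.  Suppose some p in R is adjacent to infinitely many classes of
-- R − p.  Cutting these classes apart by finite cuts yields infinitely many disjoint states
-- inside R, which share their two ends: either the end W is kept and all of them touch p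
-- (Keep), or W is replaced by a set P ⊆ R attached to W (Move).  Suppose there is no such
-- p, here or in the substates obtained by absorbing a few vertices into the two ends.
-- Absorbing vertices makes both ends adjacent to infinitely many vertices of one class K,
-- each vertex of which has only finitely many neighbours outside K; contracting the
-- components of R − K onto K then gives a football.
--
-- If no football arises, every state allows Keep or Move.  Should some state not allow Move,
-- then all its substates with the same W allow Keep, and iterating Keep gives a T_ℵ₀ * t
-- minor with branch set W for t.  Otherwise iterating Move gives one in which the sets P
-- are the branch sets of the tree, and the growing sets U unite to the branch set of t.

open import Defs
open import Level using (Level; _⊔_) renaming (suc to lsuc)
open import Axiom.ExcludedMiddle using (ExcludedMiddle)
open import Data.Empty using (⊥; ⊥-elim)
open import Data.List using (List; []; _∷_; _++_; map; concatMap; cartesianProduct; length)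
open import Data.List.Membership.Propositional using (_∈_; lose)
open import Data.List.Membership.Propositional.Properties
  using (∈-++⁺ˡ; ∈-++⁺ʳ; ∈-++⁻; ∈-map⁺; ∈-cartesianProduct⁺; ∈-concatMap⁺)
open import Data.List.Relation.Unary.Any using (here; there)
open import Data.Maybe using (Maybe; just; nothing)
open import Data.Nat using (ℕ; zero; suc; _+_; _≤_; _<_; s≤s) renaming (_⊔_ to _⊔ℕ_)
open import Data.Nat.Properties
  using (+-comm; 0≢1+n; suc-injective; m≤n⇒m<n∨m≡n; ≤-refl; ≤-trans; ≤-total; <-cmp; +-cancelˡ-≡; m≤m+n; m≤m⊔n; m≤n⊔m; m≤n⇒∃[o]m+o≡n; n≤1+n; <-irrefl)
open import Data.Product using (Σ; ∃; _×_; _,_; proj₁; proj₂)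
open import Data.Unit.Polymorphic using (⊤)
open import Data.Sum using (_⊎_; inj₁; inj₂; swap; [_,_]; [_,_]′)
open import Function using (_∘_; id)
open import Relation.Binary.Definitions using (tri<; tri≈; tri>)
open import Relation.Binary.PropositionalEquality using (_≡_; _≢_; refl; sym; cong; subst)
open import Relation.Nullary using (¬_; Dec; yes; no; recompute)
open import Relation.Unary using (Pred; _⊆_; _∪_; ｛_｝)

-- The obstacle is that a region cut off by finitely many edges need not be attached to `U` or `W`:
-- its only ways out may be `p` and the cut. The ends of the cut inside the region, joined up to a
-- finite connected hub, then act as its second end. This forces an end to be replaced, hence `Move`
-- besides `Keep`; all these hubs lie in one connected set `A°`, so that the new states still share
-- both ends.
--
-- Infinitely many classes at a vertex help only if the vertex is adjacent to `W`. To arrange this,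
-- it is put on a path between the two ends whose two sides are absorbed. A vertex separated from
-- both ends by a single other vertex lies on no such path, and is discarded beforehand (`R°`).
--
-- If no vertex sees infinitely many classes, the pigeonhole principle puts infinitely many
-- neighbours of any vertex into one class; this is how an end acquires infinitely many neighbours
-- in `K`. Each vertex of `K` must have finite degree out of `K` because an edge of the contraction
-- may stand for several edges of `G`, and finitely many of the former must be blocked by finitely
-- many of the latter.

module Walks {a r : Level} {A : Set a} {_⟶_ : A → A → Set r} where

  infixr 5 _◅◅_
  _◅◅_ : ∀ {x y z} → Walk _⟶_ x y → Walk _⟶_ y z → Walk _⟶_ x z
  here ◅◅ w = w
  step s v ◅◅ w = step s (v ◅◅ w)

  reverse : (∀ {x y} → x ⟶ y → y ⟶ x) → ∀ {x y} → Walk _⟶_ x y → Walk _⟶_ y x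
  reverse s-sym here = here
  reverse s-sym (step s w) = reverse s-sym w ◅◅ step (s-sym s) here

open Walks

gmap : ∀ {a b r s} {A : Set a} {B : Set b} {R : A → A → Set r} {S : B → B → Set s}
       (f : A → B) → (∀ {x y} → R x y → S (f x) (f y)) →
       ∀ {x y} → Walk R x y → Walk S (f x) (f y)
gmap f h here = here
gmap f h (step s w) = step (h s) (gmap f h w)

-- Infinite sets, transversals and the pigeonhole principle

module Classical (lem : ∀ {a} → ExcludedMiddle a) where

  dec : ∀ {a} (P : Set a) → Dec P
  dec P = lem

  dne : ∀ {a} {P : Set a} → ¬ ¬ P → P
  dne {P = P} h with dec P
  ... | yes p = p
  ... | no ¬p = ⊥-elim (h ¬p)

  ¬∀⇒∃¬ : ∀ {a b} {A : Set a} {P : A → Set b} → ¬ (∀ x → P x) → ∃ λ x → ¬ P x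
  ¬∀⇒∃¬ h = dne λ n → h λ x → dne λ ¬p → n (x , ¬p)

  Injective : (ℕ → ℕ) → Set
  Injective f = ∀ i j → f i ≡ f j → i ≡ j

  infinitelyOften : ∀ {a} (P : ℕ → Set a) →
    (Σ (ℕ → ℕ) λ f → Injective f × (∀ i → P (f i))) ⊎ (∃ λ N → ∀ n → N ≤ n → ¬ P n)
  infinitelyOften P with dec (∀ N → ∃ λ n → N ≤ n × P n)
  ... | no h with ¬∀⇒∃¬ h
  ...   | N , q = inj₂ (N , λ n N≤n p → q (n , N≤n , p))
  infinitelyOften P | yes h = inj₁ (f , injective , holds)
    where
    f : ℕ → ℕ
    f zero = proj₁ (h 0)
    f (suc i) = proj₁ (h (suc (f i)))
    holds : ∀ i → P (f i)
    holds zero = proj₂ (proj₂ (h 0))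
    holds (suc i) = proj₂ (proj₂ (h (suc (f i))))
    increasing : ∀ {i j} → i < j → f i < f j
    increasing {i} {suc j} (s≤s i≤j) with <-cmp i j
    ... | tri< i<j _ _ = ≤-trans (increasing i<j) (≤-trans (n≤1+n _) (proj₁ (proj₂ (h (suc (f j))))))
    ... | tri≈ _ refl _ = proj₁ (proj₂ (h (suc (f j))))
    ... | tri> _ _ j<i = ⊥-elim (<-irrefl refl (≤-trans j<i i≤j))
    injective : Injective f
    injective i j eq with <-cmp i j
    ... | tri< i<j _ _ = ⊥-elim (<-irrefl eq (increasing i<j))
    ... | tri≈ _ e _ = e
    ... | tri> _ _ j<i = ⊥-elim (<-irrefl (sym eq) (increasing j<i))

  -- If no class is infinite, the class of every `i` is bounded, and `b` takes each value past the
  -- bounds belonging to all earlier values.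
  infiniteClassOrTransversal : ∀ {a} (_≈_ : ℕ → ℕ → Set a) →
    (∀ i → i ≈ i) → (∀ {i j} → i ≈ j → j ≈ i) →
    (Σ ℕ λ i → Σ (ℕ → ℕ) λ f → Injective f × (∀ j → i ≈ f j)) ⊎
    (Σ (ℕ → ℕ) λ f → ∀ i j → f i ≈ f j → i ≡ j)
  infiniteClassOrTransversal _≈_ ≈-refl ≈-sym
    with dec (∃ λ i → Σ (ℕ → ℕ) λ f → Injective f × (∀ j → i ≈ f j))
  ... | yes (i , f , inj , q) = inj₁ (i , f , inj , q)
  ... | no h = inj₂ (b , transversal)
    where
    bound : ∀ i → ∃ λ N → ∀ n → N ≤ n → ¬ (i ≈ n)
    bound i with infinitelyOften (i ≈_)
    ... | inj₁ (f , inj , q) = ⊥-elim (h (i , f , inj , q))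
    ... | inj₂ q = q
    b : ℕ → ℕ
    b zero = 0
    b (suc n) = b n ⊔ℕ proj₁ (bound (b n))
    b-mono : ∀ {i j} → i < j → b (suc i) ≤ b j
    b-mono {i} {suc j} (s≤s i≤j) with <-cmp i j
    ... | tri< i<j _ _ = ≤-trans (b-mono i<j) (m≤m⊔n _ _)
    ... | tri≈ _ refl _ = ≤-refl
    ... | tri> _ _ j<i = ⊥-elim (<-irrefl refl (≤-trans j<i i≤j))
    apart : ∀ {i j} → i < j → ¬ (b i ≈ b j)
    apart {i} {j} i<j = proj₂ (bound (b i)) (b j) (≤-trans (m≤n⊔m (b i) _) (b-mono i<j))
    transversal : ∀ i j → b i ≈ b j → i ≡ j
    transversal i j q with <-cmp i j
    ... | tri< i<j _ _ = ⊥-elim (apart i<j q)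
    ... | tri≈ _ e _ = e
    ... | tri> _ _ j<i = ⊥-elim (apart j<i (≈-sym q))

  Infinite : ∀ {a b} {A : Set a} → Pred A b → Set (a ⊔ b)
  Infinite {A = A} S = ∀ (l : List A) → ∃ λ x → S x × ¬ x ∈ l

  pigeonhole : ∀ {a b c} {A : Set a} (S : Pred A b) (Θ : A → Pred A c) (l : List A) →
    (∀ {x} → S x → ∃ λ j → j ∈ l × Θ j x) → Infinite S →
    ∃ λ j → j ∈ l × (∀ (l′ : List A) → ∃ λ x → S x × Θ j x × ¬ x ∈ l′)
  pigeonhole {A = A} S Θ l cover inf with dec (∃ λ j → j ∈ l × (∀ (l′ : List A) → ∃ λ x → S x × Θ j x × ¬ x ∈ l′))
  ... | yes q = q
  ... | no h = ⊥-elim (all-covered (exceptions l id))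
    where
    exceptions : ∀ l₁ → (∀ {j} → j ∈ l₁ → j ∈ l) →
      ∃ λ e → ∀ {j x} → j ∈ l₁ → S x → Θ j x → x ∈ e
    exceptions [] _ = [] , λ ()
    exceptions (j ∷ l₁) sub with exceptions l₁ (sub ∘ there) | ¬∀⇒∃¬ (λ q → h (j , sub (here refl) , q))
    ... | e , q | e₁ , q₁ = e₁ ++ e , λ
      { (here refl) s θ → ∈-++⁺ˡ (dne λ n → q₁ (_ , s , θ , n))
      ; (there i) s θ → ∈-++⁺ʳ e₁ (q i s θ) }
    all-covered : (∃ λ e → ∀ {j x} → j ∈ l → S x → Θ j x → x ∈ e) → ⊥
    all-covered (e , q) with inf e
    ... | x , s , x∉e with cover s
    ...   | j , j∈l , θ = x∉e (q j∈l s θ)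

  collect : ∀ {a c d} {A : Set a} {E : Set c} (Φ : A → List E → Set d) →
    (∀ {x F F′} → (∀ {e} → e ∈ F → e ∈ F′) → Φ x F → Φ x F′) →
    ∀ l → (∀ {x} → x ∈ l → ∃ λ F → Φ x F) → ∃ λ F → ∀ {x} → x ∈ l → Φ x F
  collect Φ mono [] h = [] , λ ()
  collect Φ mono (x ∷ l) h with h (here refl) | collect Φ mono l (h ∘ there)
  ... | F , p | F′ , q = F ++ F′ , λ
    { (here refl) → mono ∈-++⁺ˡ p ; (there i) → mono (∈-++⁺ʳ F) (q i) }

-- Connectivity under finite edge deletions, and states

module Connectivity (lem : ∀ {a} → ExcludedMiddle a) {ℓ : Level} (G : Graph ℓ) where
  open Classical lem

  Vertex : Set ℓ
  Vertex = V G

  VSet : Set (lsuc ℓ)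
  VSet = Vertex → Set ℓ

  Edges : Set ℓ
  Edges = List (Vertex × Vertex)

  infix 4 _∼_
  _∼_ : Vertex → Vertex → Set ℓ
  _∼_ = _~_ G

  ∼-sym : ∀ {x y} → x ∼ y → y ∼ x
  ∼-sym = ~-sym G

  ∼⇒≢ : ∀ {x y} → x ∼ y → x ≢ y
  ∼⇒≢ e refl = ~-irr G e

  infix 4 _⊑_
  _⊑_ : Edges → Edges → Set ℓ
  F ⊑ F′ = ∀ {e} → e ∈ F → e ∈ F′

  In : List Vertex → VSet
  In l x = x ∈ l

  infixl 6 _─_
  _─_ : VSet → VSet → VSet
  (S ─ T) x = S x × ¬ T x

  Avoids : Edges → Vertex → Vertex → Set ℓ
  Avoids F x y = ¬ (x , y) ∈ F × ¬ (y , x) ∈ F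

  avoids-sym : ∀ {F x y} → Avoids F x y → Avoids F y x
  avoids-sym (a , b) = b , a

  avoids-⊑ : ∀ {F F′ x y} → F ⊑ F′ → Avoids F′ x y → Avoids F x y
  avoids-⊑ sub (a , b) = a ∘ sub , b ∘ sub

  avoids-[] : ∀ {x y} → Avoids [] x y
  avoids-[] = (λ ()) , (λ ())

  Link : VSet → Edges → Vertex → Vertex → Set ℓ
  Link S F x y = S x × S y × x ∼ y × Avoids F x y

  Conn : VSet → Edges → Vertex → Vertex → Set ℓ
  Conn S F = Walk (Link S F)

  link-sym : ∀ {S F x y} → Link S F x y → Link S F y x
  link-sym (a , b , e , o) = b , a , ∼-sym e , avoids-sym o

  conn-sym : ∀ {S F x y} → Conn S F x y → Conn S F y x
  conn-sym = reverse link-sym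

  conn-map : ∀ {S T F F′ x y} → S ⊆ T → F′ ⊑ F → Conn S F x y → Conn T F′ x y
  conn-map sub subF = gmap id λ { (a , b , e , o) → sub a , sub b , e , avoids-⊑ subF o }

  conn-⊆ : ∀ {S T F x y} → S ⊆ T → Conn S F x y → Conn T F x y
  conn-⊆ sub = conn-map sub id

  conn-⊑ : ∀ {S F F′ x y} → F′ ⊑ F → Conn S F x y → Conn S F′ x y
  conn-⊑ = conn-map id

  conn-[] : ∀ {S F x y} → Conn S F x y → Conn S [] x y
  conn-[] = conn-⊑ λ ()

  conn-closed : ∀ {S T F F′ x y} → (∀ {a b} → T a → Link S F a b → T b) → F′ ⊑ F →
    T x → Conn S F x y → Conn T F′ x y
  conn-closed cl sub t here = here
  conn-closed cl sub t (step l@(_ , _ , e , o) w) =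
    step (t , cl t l , e , avoids-⊑ sub o) (conn-closed cl sub (cl t l) w)

  conn-end : ∀ {S F x y} → S x → Conn S F x y → S y
  conn-end s here = s
  conn-end s (step (_ , s′ , _) w) = conn-end s′ w

  Comp : VSet → Edges → Vertex → VSet
  Comp S F x y = S y × Conn S F x y

  Comp-step : ∀ {S F x a b} → Comp S F x a → Link S F a b → Comp S F x b
  Comp-step (s , w) l@(_ , s′ , _) = s′ , w ◅◅ step l here

  Comp-connected : ∀ {S F x y z} → S x → Comp S F x y → Comp S F x z → Conn (Comp S F x) F y z
  Comp-connected s (_ , w) (_ , w′) = conn-sym (from-root w) ◅◅ from-root w′
    where
    from-root : ∀ {y} → Conn _ _ _ y → Conn _ _ _ y
    from-root = conn-closed Comp-step id (s , here)

  finiteWalk : ∀ {S F x y} → S x → Conn S F x y →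
    ∃ λ l → (∀ {z} → z ∈ l → S z) × x ∈ l × y ∈ l × (∀ {z} → z ∈ l → Conn (In l) F x z)
  finiteWalk s here = _ ∷ [] , (λ { (here refl) → s }) , here refl , here refl , λ { (here refl) → here }
  finiteWalk s (step {x} {x′} (_ , s′ , e , o) w) with finiteWalk s′ w
  ... | l , sub , x∈l , y∈l , c = x ∷ l
    , (λ { (here refl) → s ; (there i) → sub i }) , here refl , there y∈l
    , λ { (here refl) → here
        ; (there i) → step (here refl , there x∈l , e , o) (conn-⊆ there (c i)) }

  Att : VSet → VSet
  Att U x = ∃ λ y → U y × x ∼ y

  Near : VSet → VSet → VSet
  Near U W x = Att U x ⊎ Att W x

  Connected : VSet → Set ℓ
  Connected S = ∀ {x y} → S x → S y → Conn S [] x y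

  connected-∪ : ∀ {S T} → Connected S → (∀ {x} → T x → ∃ λ y → Conn T [] x y × T y × Att S y) →
    Connected (S ∪ T)
  connected-∪ {S} {T} conn reach = λ x y →
    let a , s , w = root x ; b , t , w′ = root y
    in w ◅◅ conn-⊆ inj₁ (conn s t) ◅◅ conn-sym w′
    where
    root : ∀ {x} → (S ∪ T) x → ∃ λ a → S a × Conn (S ∪ T) [] x a
    root (inj₁ s) = _ , s , here
    root (inj₂ t) with reach t
    ... | y , w , ty , a , sa , e = a , sa , conn-⊆ inj₂ w ◅◅ step (inj₂ ty , inj₁ sa , e , avoids-[]) here

  connected-∪-touch : ∀ {S T} → Connected S → Connected T → (∃ λ y → T y × Att S y) → Connected (S ∪ T)
  connected-∪-touch c d (y , t , a) = connected-∪ c λ t′ → y , d t′ t , t , a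

  connected-In : ∀ {l x} → (∀ {z} → z ∈ l → Conn (In l) [] x z) → Connected (In l)
  connected-In c i j = conn-sym (c i) ◅◅ c j

  Same : VSet → Vertex → Vertex → Set ℓ
  Same S x y = ∀ F → Conn S F x y

  same-sym : ∀ {S x y} → Same S x y → Same S y x
  same-sym h F = conn-sym (h F)

  same-trans : ∀ {S x y z} → Same S x y → Same S y z → Same S x z
  same-trans h k F = h F ◅◅ k F

  ¬same⇒separated : ∀ {S x y} → ¬ Same S x y → ∃ λ F → ¬ Conn S F x y
  ¬same⇒separated = ¬∀⇒∃¬

  same-closed : ∀ {S T x y} → (∀ {a b} → T a → S a → S b → a ∼ b → T b) → T x → Same S x y → Same T x y
  same-closed cl t h F = conn-closed (λ { t′ (a , b , e , _) → cl t′ a b e }) id t (h F)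

  hitOrAvoid : ∀ {S F x y} (T : VSet) → S x → ¬ T x → Conn S F x y →
    (∃ λ z → ∃ λ t → Comp (S ─ T) F x z × S t × T t × z ∼ t × Avoids F z t) ⊎ (¬ T y × Conn (S ─ T) F x y)
  hitOrAvoid T s ¬t here = inj₂ (¬t , here)
  hitOrAvoid T s ¬t (step {y = x′} (_ , s′ , e , o) w) with dec (T x′)
  ... | yes t′ = inj₁ (_ , x′ , ((s , ¬t) , here) , s′ , t′ , e , o)
  ... | no ¬t′ with hitOrAvoid T s′ ¬t′ w
  ...   | inj₁ (z , t , (sz , c) , q) = inj₁ (z , t , (sz , step ((s , ¬t) , (s′ , ¬t′) , e , o) c) , q)
  ...   | inj₂ (¬ty , c) = inj₂ (¬ty , step ((s , ¬t) , (s′ , ¬t′) , e , o) c)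

  firstHit : ∀ {S F x y} (T : VSet) → S x → ¬ T x → T y → Conn S F x y →
    ∃ λ z → ∃ λ t → Comp (S ─ T) F x z × S t × T t × z ∼ t × Avoids F z t
  firstHit T s ¬t ty w = [ id , (λ (¬ty , _) → ⊥-elim (¬ty ty)) ]′ (hitOrAvoid T s ¬t w)

  -- With N contracted to a single vertex, no finite set of edges of R ∪ N separates
  -- a vertex of R from it: F lists deleted edges of R, and L the ends in R of deleted edges to N.
  Spread : VSet → VSet → Set ℓ
  Spread N R = ∀ {x} → R x → ∀ F L → ∃ λ y → Comp R F x y × ¬ y ∈ L × N y

  spread-mono : ∀ {N N′ R} → (∀ {y} → R y → N y → N′ y) → Spread N R → Spread N′ R
  spread-mono sub h r F L with h r F L
  ... | y , c@(ry , _) , y∉L , n = y , c , y∉L , sub ry n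

  spread-restrict : ∀ {N R Z : VSet} → Spread N R → Z ⊆ R → ∀ E bl →
    (∀ {x y} → Z x → R y → x ∼ y → Avoids E x y → ¬ y ∈ bl → Z y) →
    Spread (λ y → N y ⊎ Att (In bl) y) Z
  spread-restrict {N} {R} {Z} h sub E bl closed {x} z F L = truncate z (proj₂ (proj₁ (proj₂ reach)))
      (proj₁ (proj₂ (proj₂ reach))) (proj₂ (proj₂ (proj₂ reach)))
    where
    -- Without the edges in `E`, the set `Z` can be left only into `bl`; without those from `L` to
    -- `bl`, the last vertex before `bl` lies outside `L`.
    F′ = F ++ E ++ cartesianProduct L bl
    reach = h (sub z) F′ L
    truncate : ∀ {c y} → Z c → Conn R F′ c y → ¬ y ∈ L → N y →
      ∃ λ y′ → Comp Z F c y′ × ¬ y′ ∈ L × (N y′ ⊎ Att (In bl) y′)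
    truncate zc here y∉L n = _ , (zc , here) , y∉L , inj₁ n
    truncate {c} zc (step {y = c′} (_ , r , e , o) w) y∉L n with dec (c′ ∈ bl)
    ... | yes i = c , (zc , here)
        , (λ c∈L → proj₁ o (∈-++⁺ʳ F (∈-++⁺ʳ E (∈-cartesianProduct⁺ c∈L i)))) , inj₂ (c′ , i , e)
    ... | no c′∉bl with closed zc r e (avoids-⊑ (∈-++⁺ʳ F ∘ ∈-++⁺ˡ) o) c′∉bl
    ...   | z′ with truncate z′ w y∉L n
    ...     | y′ , (zy , c″) , q = y′ , (zy , step (zc , z′ , e , avoids-⊑ ∈-++⁺ˡ o) c″) , q

  -- With the edges from `x` to `l` deleted and `x` itself excluded as a target, the walk has to
  -- leave `x`, and its first step ends outside `l`.
  infinite-degree : ∀ {N R x} → Spread N R → R x → Infinite (λ y → R y × x ∼ y)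
  infinite-degree {x = x} h r l with h r (map (x ,_) l) (x ∷ [])
  ... | _ , (_ , here) , y∉ , _ = ⊥-elim (y∉ (here refl))
  ... | _ , (_ , step {y = n} (_ , rn , e , (o , _)) _) , _ = n , (rn , e) , o ∘ ∈-map⁺ (x ,_)

  record State (U W R : VSet) : Set ℓ where
    field
      U∩W : ∀ {x} → U x → ¬ W x
      U∩R : ∀ {x} → U x → ¬ R x
      W∩R : ∀ {x} → W x → ¬ R x
      connU : Connected U
      connW : Connected W
      connR : Connected R
      attU : ∃ λ x → R x × Att U x
      attW : ∃ λ x → R x × Att W x
      spread : Spread (Near U W) R

  swapState : ∀ {U W R} → State U W R → State W U R
  swapState σ = record
    { U∩W = λ w u → U∩W u w ; U∩R = W∩R ; W∩R = U∩R ; connU = connW ; connW = connU ; connR = connR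
    ; attU = attW ; attW = attU ; spread = spread-mono (λ _ → swap) spread }
    where open State σ

-- Branching of a state into infinitely many disjoint states

module Branching (lem : ∀ {a} → ExcludedMiddle a) {ℓ : Level} (G : Graph ℓ) where
  open Classical lem
  open Connectivity lem G

  Disjoint : (ℕ → VSet) → Set ℓ
  Disjoint Rs = ∀ {i j x} → Rs i x → Rs j x → i ≡ j

  -- In the tree minor, `p` joins a branch set to those of its children; hence every state has to
  -- touch it.
  record Keep (U W R : VSet) : Set (lsuc ℓ) where
    field
      {U′} : VSet
      {p} : Vertex
      {Rs} : ℕ → VSet
      states : ∀ i → State U′ W (Rs i)
      U⊆U′ : U ⊆ U′
      U′⊆ : U′ ⊆ U ∪ R
      p∈U′ : U′ p
      p∈R : R p
      Rs⊆R : ∀ {i} → Rs i ⊆ R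
      disjoint : Disjoint Rs
      touch : ∀ i → ∃ λ x → Rs i x × x ∼ p

  -- When moves are iterated, `W` is the set `P` of the preceding move, so `attP` supplies the edges
  -- of the tree.
  record Move (U W R : VSet) : Set (lsuc ℓ) where
    field
      {U′ P} : VSet
      {Rs} : ℕ → VSet
      states : ∀ i → State U′ P (Rs i)
      U⊆U′ : U ⊆ U′
      U′⊆ : U′ ⊆ U ∪ R
      P⊆R : P ⊆ R
      attP : ∃ λ x → P x × Att W x
      Rs⊆R : ∀ {i} → Rs i ⊆ R
      disjoint : Disjoint Rs

  avoidsEventually : ∀ {Rs : ℕ → VSet} → Disjoint Rs → ∀ l → ∃ λ N → ∀ i {x} → x ∈ l → ¬ Rs (N + i) x
  avoidsEventually {Rs} dis [] = 0 , λ _ ()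
  avoidsEventually {Rs} dis (x ∷ l) with dec (∃ λ i → Rs i x) | avoidsEventually {Rs} dis l
  ... | no ¬h | N , q = N , λ { i (here refl) r → ¬h (_ , r) ; i (there m) r → q i m r }
  ... | yes (k , rk) | N , q = suc k ⊔ℕ N , λ
      { i (here refl) r → <-irrefl (dis rk r) (≤-trans (m≤m⊔n (suc k) N) (m≤m+n _ i))
      ; i (there m) r →
          let d , eq = m≤n⇒∃[o]m+o≡n (≤-trans (m≤n⊔m (suc k) N) (m≤m+n (suc k ⊔ℕ N) i))
          in q d m (reindex (sym eq) r) }
    where
    reindex : ∀ {m n y} → m ≡ n → Rs m y → Rs n y
    reindex refl r = r

  record Region (R : VSet) (p : Vertex) (Z : VSet) : Set ℓ where
    field
      sub : Z ⊆ R ─ ｛ p ｝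
      connected : Connected Z
      boundary : Edges
      closed : ∀ {x y} → Z x → (R ─ ｛ p ｝) y → x ∼ y → Avoids boundary x y → Z y
      touch : ∃ λ x → Z x × x ∼ p

  region-spread : ∀ {N R p Z} → Spread N R → Region R p Z → Spread (λ y → N y ⊎ Att ｛ p ｝ y) Z
  region-spread {p = p} sp rg = spread-mono
    (λ { _ (inj₁ n) → inj₁ n ; _ (inj₂ (_ , here refl , e)) → inj₂ (p , refl , e) })
    (spread-restrict sp (proj₁ ∘ sub) boundary (p ∷ [])
      λ z r e o y∉ → closed z (r , λ { refl → y∉ (here refl) }) e o)
    where open Region rg

  module _ {U W R : VSet} (σ : State U W R) {p : Vertex} (p∈R : R p) (p~W : Att W p)
           (Zs : ℕ → VSet) (regions : ∀ i → Region R p (Zs i)) (disjoint : Disjoint Zs) where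
    open State σ

    private module Z i = Region (regions i)

    -- If infinitely many regions touch `W`, then `W` stays and `U` is extended by a finite walk to
    -- `p`; the finitely many regions that the walk meets are dropped. Otherwise almost all regions
    -- touch `U` but not `W`, and `p` alone becomes the new second end.
    attachedRegions : (∀ i → ∃ λ x → Zs i x × Near U W x) → Keep U W R ⊎ Move U W R
    attachedRegions att with infinitelyOften (λ i → ∃ λ x → Zs i x × Att W x)
    ... | inj₁ (f , inj , attW′) = inj₁ record
          { states = λ i → record
              { U∩W = [ U∩W , (λ m w → W∩R w (l⊆R m)) ]′
              ; U∩R = [ (λ u z → U∩R u (proj₁ (Z.sub _ z))) , (λ m → avoid i m) ]′
              ; W∩R = λ w z → W∩R w (proj₁ (Z.sub _ z))
              ; connU = connected-∪-touch connU (connected-In l-conn) (_ , y∈l , y~U)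
              ; connW = connW ; connR = Z.connected _
              ; attU = let x , z , e = Z.touch (f (N + i)) in x , z , p , inj₂ p∈l , e
              ; attW = attW′ (N + i)
              ; spread = spread-mono
                  (λ { _ (inj₁ (inj₁ (a , u , e))) → inj₁ (a , inj₁ u , e) ; _ (inj₁ (inj₂ w)) → inj₂ w
                     ; _ (inj₂ (_ , refl , e)) → inj₁ (p , inj₂ p∈l , e) })
                  (region-spread spread (regions _)) }
          ; U⊆U′ = inj₁ ; U′⊆ = [ inj₁ , inj₂ ∘ l⊆R ]′
          ; p∈U′ = inj₂ p∈l ; p∈R = p∈R ; Rs⊆R = proj₁ ∘ Z.sub _
          ; disjoint = λ z z′ → +-cancelˡ-≡ N _ _ (inj _ _ (disjoint z z′))
          ; touch = λ i → Z.touch _ }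
      where
      y~U = proj₂ (proj₂ attU)
      walk = finiteWalk p∈R (connR p∈R (proj₁ (proj₂ attU)))
      l = proj₁ walk
      l⊆R = proj₁ (proj₂ walk)
      p∈l = proj₁ (proj₂ (proj₂ walk))
      y∈l = proj₁ (proj₂ (proj₂ (proj₂ walk)))
      l-conn = proj₂ (proj₂ (proj₂ (proj₂ walk)))
      late = avoidsEventually {Zs ∘ f} (λ z z′ → inj _ _ (disjoint z z′)) l
      N = proj₁ late
      avoid = proj₂ late
    ... | inj₂ (N , unattached) = inj₂ record
          { states = λ i → record
              { U∩W = λ { u refl → U∩R u p∈R }
              ; U∩R = λ u z → U∩R u (proj₁ (Z.sub _ z))
              ; W∩R = λ w z → proj₂ (Z.sub _ z) w
              ; connU = connU ; connW = λ { refl refl → here } ; connR = Z.connected _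
              ; attU = [ (λ a → a) , (λ a → ⊥-elim (unattached (N + i) (m≤m+n N i) a)) ]′ (side (att (N + i)))
              ; attW = let x , z , e = Z.touch (N + i) in x , z , p , refl , e
              ; spread = spread-mono
                  (λ { _ (inj₁ (inj₁ u)) → inj₁ u
                     ; z (inj₁ (inj₂ w)) → ⊥-elim (unattached (N + i) (m≤m+n N i) (_ , z , w))
                     ; _ (inj₂ a) → inj₂ a })
                  (region-spread spread (regions _)) }
          ; U⊆U′ = id ; U′⊆ = inj₁ ; P⊆R = λ { refl → p∈R } ; attP = p , refl , p~W
          ; Rs⊆R = proj₁ ∘ Z.sub _
          ; disjoint = λ z z′ → +-cancelˡ-≡ N _ _ (disjoint z z′) }
      where
      side : ∀ {Z : VSet} → (∃ λ x → Z x × Near U W x) → (∃ λ x → Z x × Att U x) ⊎ (∃ λ x → Z x × Att W x)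
      side (x , z , inj₁ a) = inj₁ (x , z , a)
      side (x , z , inj₂ a) = inj₂ (x , z , a)

-- Cutting off regions around a vertex

module Cutting (lem : ∀ {a} → ExcludedMiddle a) {ℓ : Level} (G : Graph ℓ) where
  open Classical lem
  open Connectivity lem G
  open Branching lem G

  component-region : ∀ {R p E n} → (R ─ ｛ p ｝) n → n ∼ p → Region R p (Comp (R ─ ｛ p ｝) E n)
  component-region {E = E} n∈ n~p = record
    { sub = proj₁ ; connected = λ c c′ → conn-[] (Comp-connected n∈ c c′) ; boundary = E
    ; closed = λ { c@(x∈ , _) y∈ e o → Comp-step c (x∈ , y∈ , e , o) }
    ; touch = _ , (n∈ , here) , n~p }

  -- A region is cut off by a finite edge cut between two inequivalent neighbours
  -- of p, on whose other side the neighbours of p still fill infinitely many classes.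
  module _ {R : VSet} {p : Vertex} where

    private
      X : VSet
      X = R ─ ｛ p ｝

    Rich : VSet → Set ℓ
    Rich T = ∀ l → ∃ λ n → T n × n ∼ p × (∀ {m} → m ∈ l → ¬ Same X m n)

    rich-split : ∀ {T A B} → Rich T → T ⊆ A ∪ B → Rich A ⊎ Rich B
    rich-split {T} {A} {B} rich cover with dec (Rich A) | dec (Rich B)
    ... | yes a | _ = inj₁ a
    ... | no _ | yes b = inj₂ b
    ... | no ¬a | no ¬b with ¬∀⇒∃¬ ¬a | ¬∀⇒∃¬ ¬b
    ...   | l , no-a | l′ , no-b with rich (l ++ l′)
    ...     | n , t , e , new with cover t
    ...       | inj₁ a = ⊥-elim (no-a (n , a , e , new ∘ ∈-++⁺ˡ))
    ...       | inj₂ b = ⊥-elim (no-b (n , b , e , new ∘ ∈-++⁺ʳ l))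

    record Reservoir : Set (lsuc ℓ) where
      field
        {Y} : VSet
        sub : Y ⊆ X
        boundary : Edges
        closed : ∀ {x y} → Y x → X y → x ∼ y → Avoids boundary x y → Y y
        rich : Rich Y
    open Reservoir

    record Cut (r : Reservoir) : Set (lsuc ℓ) where
      field
        {Z} : VSet
        region : Region R p Z
        Z⊆Y : Z ⊆ Y r
        rest : Reservoir
        rest⊆Y : Y rest ⊆ Y r
        apart : ∀ {x} → Z x → ¬ Y rest x

    cut : ∀ r → Cut r
    cut r with rich r []
    ... | n₁ , y₁ , e₁ , _ with rich r (n₁ ∷ [])
    ...   | n₂ , y₂ , e₂ , new with ¬same⇒separated (new (here refl))
    ...     | F , ¬w = choose (rich-split (rich r) split)
      where
      -- The old boundary is included because both sides have to be closed relative to `X`, and not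
      -- only within the reservoir.
      E = boundary r ++ F
      S : VSet
      S = Conn X F n₁
      In-side Out-side : VSet
      In-side x = Y r x × S x
      Out-side = Y r ─ S
      split : Y r ⊆ In-side ∪ Out-side
      split {x} y with dec (S x)
      ... | yes s = inj₁ (y , s)
      ... | no ¬s = inj₂ (y , ¬s)
      in-closed : ∀ {x y} → In-side x → X y → x ∼ y → Avoids E x y → In-side y
      in-closed (y , s) x′ e o = closed r y x′ e (avoids-⊑ ∈-++⁺ˡ o)
        , s ◅◅ step (sub r y , x′ , e , avoids-⊑ (∈-++⁺ʳ (boundary r)) o) here
      out-closed : ∀ {x y} → Out-side x → X y → x ∼ y → Avoids E x y → Out-side y
      out-closed (y , ¬s) x′ e o = closed r y x′ e (avoids-⊑ ∈-++⁺ˡ o)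
        , λ s → ¬s (s ◅◅ step (x′ , sub r y , ∼-sym e , avoids-sym (avoids-⊑ (∈-++⁺ʳ (boundary r)) o)) here)
      within : ∀ {T : VSet} {n} → (∀ {x y} → T x → X y → x ∼ y → Avoids E x y → T y) → T n → Comp X E n ⊆ T
      within cl t (_ , w) = conn-end t (conn-closed (λ { t′ (_ , x′ , e , o) → cl t′ x′ e o }) id t w)
      -- The rich side becomes the next reservoir; the region is the component of whichever of `n₁`
      -- and `n₂` lies on the other side.
      choose : Rich In-side ⊎ Rich Out-side → Cut r
      choose (inj₁ rich-in) = record
        { region = component-region (sub r y₂) e₂
        ; Z⊆Y = proj₁ ∘ within out-closed (y₂ , ¬w)
        ; rest = record { sub = sub r ∘ proj₁ ; boundary = E ; closed = in-closed ; rich = rich-in }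
        ; rest⊆Y = proj₁ ; apart = λ z i → proj₂ (within out-closed (y₂ , ¬w) z) (proj₂ i) }
      choose (inj₂ rich-out) = record
        { region = component-region (sub r y₁) e₁
        ; Z⊆Y = proj₁ ∘ within in-closed (y₁ , here)
        ; rest = record { sub = sub r ∘ proj₁ ; boundary = E ; closed = out-closed ; rich = rich-out }
        ; rest⊆Y = proj₁ ; apart = λ z o → proj₂ o (proj₂ (within in-closed (y₁ , here) z)) }

    disjointRegions : Rich X → ∃ λ (Zs : ℕ → VSet) → (∀ i → Region R p (Zs i)) × Disjoint Zs
    disjointRegions rich₀ = (λ i → C.Z i) , (λ i → C.region i) , disjoint
      where
      stage : ℕ → Reservoir
      stage zero = record { sub = id ; boundary = [] ; closed = λ _ x′ _ _ → x′ ; rich = rich₀ }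
      stage (suc i) = Cut.rest (cut (stage i))
      module C i = Cut (cut (stage i))
      later : ∀ {i j} → i < j → Y (stage j) ⊆ Y (stage (suc i))
      later {i} {suc j} (s≤s i≤j) with <-cmp i j
      ... | tri< i<j _ _ = later i<j ∘ C.rest⊆Y j
      ... | tri≈ _ refl _ = id
      ... | tri> _ _ j<i = ⊥-elim (<-irrefl refl (≤-trans j<i i≤j))
      disjoint : Disjoint (λ i → C.Z i)
      disjoint {i} {j} z z′ with <-cmp i j
      ... | tri< i<j _ _ = ⊥-elim (C.apart i z (later i<j (C.Z⊆Y j z′)))
      ... | tri≈ _ e _ = e
      ... | tri> _ _ j<i = ⊥-elim (C.apart j z′ (later j<i (C.Z⊆Y i z)))

  -- The hub stands in for the missing second end of a region attached neither to `U` nor to `W`.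
  -- Being finite, it cannot contain all neighbours of `p` in such a region.
  record Hub (R : VSet) (p : Vertex) (Z : VSet) : Set ℓ where
    field
      {root} : Vertex
      hub : List Vertex
      root∈ : root ∈ hub
      hub⊆Z : In hub ⊆ Z
      connected : Connected (In hub)
      exit : ∀ {x y} → Z x → (R ─ ｛ p ｝) y → x ∼ y → ¬ Z y → x ∈ hub

  -- Vertices from which `Z` can be left are among the ends of its finite boundary; walks in `Z`
  -- from one root join them to a finite connected set.
  hub : ∀ {R p Z} → Region R p Z → Hub R p Z
  hub {R} {p} {Z} rg = record
    { hub = proj₁ (visits ends)
    ; root∈ = proj₁ (proj₂ (visits ends))
    ; hub⊆Z = proj₁ (proj₂ (proj₂ (visits ends)))
    ; connected = connected-In (proj₁ (proj₂ (proj₂ (proj₂ (visits ends)))))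
    ; exit = λ z r e ¬z → proj₂ (proj₂ (proj₂ (proj₂ (visits ends)))) (exit-end z r e ¬z) z }
    where
    open Region rg
    root = proj₁ touch
    rz = proj₁ (proj₂ touch)
    ends = map proj₁ boundary ++ map proj₂ boundary
    exit-end : ∀ {x y} → Z x → (R ─ ｛ p ｝) y → x ∼ y → ¬ Z y → x ∈ ends
    exit-end {x} {y} z r e ¬z with dec ((x , y) ∈ boundary) | dec ((y , x) ∈ boundary)
    ... | yes i | _ = ∈-++⁺ˡ (∈-map⁺ proj₁ i)
    ... | no _ | yes i = ∈-++⁺ʳ (map proj₁ boundary) (∈-map⁺ proj₂ i)
    ... | no i | no j = ⊥-elim (¬z (closed z r e (i , j)))
    visits : ∀ xs → ∃ λ l → root ∈ l × In l ⊆ Z × (∀ {x} → x ∈ l → Conn (In l) [] root x) ×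
      (∀ {x} → x ∈ xs → Z x → x ∈ l)
    visits [] = root ∷ [] , here refl , (λ { (here refl) → rz }) , (λ { (here refl) → here }) , λ ()
    visits (x ∷ xs) with visits xs | dec (Z x)
    ... | l , r , sub′ , c , h | no ¬z =
      l , r , sub′ , c , λ { (here refl) z → ⊥-elim (¬z z) ; (there i) → h i }
    ... | l , r , sub′ , c , h | yes z with finiteWalk rz (connected rz z)
    ...   | l′ , sub″ , _ , x∈ , c′ = l ++ l′ , ∈-++⁺ˡ r
      , (λ i → [ sub′ , sub″ ]′ (∈-++⁻ l i))
      , (λ i → [ conn-⊆ ∈-++⁺ˡ ∘ c , conn-⊆ (∈-++⁺ʳ l) ∘ c′ ]′ (∈-++⁻ l i))
      , λ { (here refl) _ → ∈-++⁺ʳ l x∈ ; (there i) z′ → ∈-++⁺ˡ (h i z′) }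

-- Vertices adjacent to infinitely many classes

module WideVertex (lem : ∀ {a} → ExcludedMiddle a) {ℓ : Level} (G : Graph ℓ) where
  open Classical lem
  open Connectivity lem G
  open Branching lem G
  open Cutting lem G

  module _ {U W R : VSet} (σ : State U W R) {p : Vertex} (p∈R : R p) where
    open State σ

    private
      X : VSet
      X = R ─ ｛ p ｝

    -- After its last visit to p, a walk from p to U no longer meets A.
    bypass : ∀ {A : VSet} → (∀ {x y} → A x → X y → x ∼ y → A y) → (∀ {x} → A x → ¬ Att U x) →
      ∃ λ y → Comp (R ─ A) [] p y × Att U y
    bypass {A} A-closed A≁U = let y , r , y~U = attU in [ proj₂ , id ]′ (tail p∈R (connR p∈R r) y~U)
      where
      Escape : Vertex → Set ℓ
      Escape c = ∃ λ y → Comp (R ─ A) [] c y × Att U y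
      tail : ∀ {c y} → R c → Conn R [] c y → Att U y → (¬ A c × Escape c) ⊎ Escape p
      tail r here y~U = inj₁ ((λ a → A≁U a y~U) , _ , ((r , λ a → A≁U a y~U) , here) , y~U)
      tail {c} r (step {y = c′} (_ , r′ , e , _) w) y~U with tail r′ w y~U
      ... | inj₂ d = inj₂ d
      ... | inj₁ (¬a′ , d@(z , (rz , w′) , z~U)) with dec (A c)
      ...   | no ¬a = inj₁ (¬a , z , (rz , step ((r , ¬a) , (r′ , ¬a′) , e , avoids-[]) w′) , z~U)
      ...   | yes a with dec (p ≡ c′)
      ...     | yes refl = inj₂ d
      ...     | no p≢c′ = ⊥-elim (¬a′ (A-closed a (r′ , p≢c′) e))

    module _ {A : VSet} (A⊆X : A ⊆ X) (A-connected : Connected A)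
             (A-closed : ∀ {x y} → A x → X y → x ∼ y → A y)
             (Zs : ℕ → VSet) (Zs⊆A : ∀ {i} → Zs i ⊆ A)
             (regions : ∀ i → Region R p (Zs i)) (disjoint : Disjoint Zs)
             (unattached : ∀ {i x} → Zs i x → ¬ Near U W x) where

      private
        module Z i = Region (regions i)
        module H i = Hub (hub (regions i))

        -- A with each region Zs i shrunk to its hub
        A° : VSet
        A° x = A x × (∀ i → Zs i x → x ∈ H.hub i)

        hub⊆A° : ∀ {i} → In (H.hub i) ⊆ A°
        hub⊆A° {i} m = Zs⊆A (H.hub⊆Z i m) , λ j z → same-hub (disjoint (H.hub⊆Z i m) z) m
          where
          same-hub : ∀ {i j x} → i ≡ j → x ∈ H.hub i → x ∈ H.hub j
          same-hub refl m = m

        leave : ∀ {x} → A x → ¬ A° x → ∃ λ i → Zs i x × ¬ x ∈ H.hub i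
        leave a ¬a° with ¬∀⇒∃¬ (λ h → ¬a° (a , h))
        ... | i , h = i , dne (λ ¬z → h (⊥-elim ∘ ¬z)) , λ m → h λ _ → m

        -- A walk through a shrunk region enters and leaves it through its hub.
        reroute : ∀ {c y} → Conn A [] c y → A° y →
          (A° c → Conn A° [] c y) ×
          (∀ {i a} → Zs i c → ¬ c ∈ H.hub i → a ∈ H.hub i → Conn A° [] a y)
        reroute here (_ , y°) = (λ _ → here) , λ z ∉hub _ → ⊥-elim (∉hub (y° _ z))
        reroute (step {y = c′} (a , a′ , e , o) w) y° with reroute w y°
        ... | from-A° , from-region = outside , inside
          where
          outside : A° _ → Conn A° [] _ _
          outside c° with dec (A° c′)
          ... | yes c′° = step (c° , c′° , e , o) (from-A° c′°)
          ... | no ¬c′° with leave a′ ¬c′°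
          ...   | i , z′ , ∉hub with dec (Zs i _)
          ...     | yes z = from-region z′ ∉hub (proj₂ c° i z)
          ...     | no ¬z = ⊥-elim (∉hub (H.exit i z′ (A⊆X a) (∼-sym e) ¬z))
          inside : ∀ {i b} → Zs i _ → ¬ _ ∈ H.hub i → b ∈ H.hub i → Conn A° [] b _
          inside {i} z ∉hub b with dec (Zs i c′)
          ... | no ¬z′ = ⊥-elim (∉hub (H.exit i z (A⊆X a′) e ¬z′))
          ... | yes z′ with dec (c′ ∈ H.hub i)
          ...   | yes m = conn-⊆ hub⊆A° (H.connected i b m) ◅◅ from-A° (hub⊆A° m)
          ...   | no ∉hub′ = from-region z′ ∉hub′ b

        A°-connected : Connected A°
        A°-connected x° y° = proj₁ (reroute (A-connected (proj₁ x°) (proj₁ y°)) y°) x°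

        -- The region has no neighbour in `U` or `W`, so excluding the finite hub as a target leaves
        -- only neighbours of `p` outside the hub.
        entry : ∀ i → ∃ λ y → (Zs i ─ In (H.hub i)) y × y ∼ p
        entry i with region-spread spread (regions i) (H.hub⊆Z i (H.root∈ i)) [] (H.hub i)
        ... | y , (z , _) , ∉hub , inj₁ near = ⊥-elim (unattached z near)
        ... | y , (z , _) , ∉hub , inj₂ (_ , refl , e) = y , (z , ∉hub) , e

        -- Removing the hub may disconnect the region. A component containing a neighbour of `p`
        -- touches both new ends: `p` directly, and the hub because the region is connected.
        S : ℕ → VSet
        S i = Comp (Zs i ─ In (H.hub i)) [] (proj₁ (entry i))

        S⊆Z : ∀ {i} → S i ⊆ Zs i
        S⊆Z ((z , _) , _) = z

        S-connected : ∀ {i} → Connected (S i)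
        S-connected {i} = Comp-connected (proj₁ (proj₂ (entry i)))

        S-touches-p : ∀ i → ∃ λ x → S i x × Att ｛ p ｝ x
        S-touches-p i with entry i
        ... | y , zy , e = y , (zy , here) , p , refl , e

        S-touches-A° : ∀ i → ∃ λ x → S i x × Att A° x
        S-touches-A° i with entry i
        ... | y , (z , ∉hub) , _
            with firstHit (In (H.hub i)) z ∉hub (H.root∈ i) (Z.connected i z (H.hub⊆Z i (H.root∈ i)))
        ...   | x , t , c , _ , t∈hub , e , _ = x , c , t , hub⊆A° t∈hub , e

        S∩A° : ∀ {i x} → A° x → ¬ S i x
        S∩A° (_ , h) ((z , ∉hub) , _) = ∉hub (h _ z)

        -- Every edge of `R − p` that leaves the region starts in its hub, so `S i` can be left only
        -- to `p`, to the hub or along finitely many boundary edges.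
        S-spread : ∀ i → Spread (λ y → Att ｛ p ｝ y ⊎ Att A° y) (S i)
        S-spread i = spread-mono
          (λ { s (inj₁ near) → ⊥-elim (unattached (S⊆Z s) near)
             ; s (inj₂ (_ , here refl , e)) → inj₁ (p , refl , e)
             ; s (inj₂ (b , there m , e)) → inj₂ (b , hub⊆A° m , e) })
          (spread-restrict spread (proj₁ ∘ Z.sub i ∘ S⊆Z) (Z.boundary i) (p ∷ H.hub i)
            λ s r e o ∉bl → Comp-step s (proj₁ s
              , (Z.closed i (S⊆Z s) (r , λ { refl → ∉bl (here refl) }) e o , ∉bl ∘ there) , e , avoids-[]))

        A°⊆R : A° ⊆ R
        A°⊆R = proj₁ ∘ A⊆X ∘ proj₁

        near⇒A° : ∀ {x} → A x → Near U W x → A° x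
        near⇒A° a near = a , λ i z → ⊥-elim (unattached z near)

      -- The ends of the new states are `p`, which touches `W`, and `A°`, which can be joined to `U`
      -- because `A` touches `U`.
      move-at-p : Att W p → (∃ λ x → A x × Att U x) → Move U W R
      move-at-p p~W (x , a , x~U) = record
        { states = λ i → record
            { U∩W = λ { (inj₁ u) refl → U∩R u p∈R ; (inj₂ a°) refl → proj₂ (A⊆X (proj₁ a°)) refl }
            ; U∩R = λ { (inj₁ u) s → U∩R u (proj₁ (Z.sub i (S⊆Z s))) ; (inj₂ a°) s → S∩A° a° s }
            ; W∩R = λ q s → proj₂ (Z.sub i (S⊆Z s)) q
            ; connU = connected-∪-touch connU A°-connected (x , near⇒A° a (inj₁ x~U) , x~U)
            ; connW = λ { refl refl → here } ; connR = S-connected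
            ; attU = let y , s , b , m , e = S-touches-A° i in y , s , b , inj₂ m , e
            ; attW = S-touches-p i
            ; spread = spread-mono
                (λ { _ (inj₁ q) → inj₂ q ; _ (inj₂ (b , m , e)) → inj₁ (b , inj₂ m , e) }) (S-spread i) }
        ; U⊆U′ = inj₁ ; U′⊆ = [ inj₁ , inj₂ ∘ A°⊆R ]′ ; P⊆R = λ { refl → p∈R } ; attP = p , refl , p~W
        ; Rs⊆R = proj₁ ∘ Z.sub _ ∘ S⊆Z ; disjoint = λ s s′ → disjoint (S⊆Z s) (S⊆Z s′) }

      -- The roles are exchanged: `A°` touches `W` and becomes `P`, while `p` goes to the first end.
      -- By `bypass` it reaches `U` outside `A`, so it lies in the set `D` that is absorbed.
      move-away-from-p : (∀ {x} → A x → ¬ Att U x) → (∃ λ x → A x × Att W x) → Move U W R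
      move-away-from-p A≁U (x , a , x~W) = record
        { states = λ i → record
            { U∩W = λ { (inj₁ u) a° → U∩R u (A°⊆R a°) ; (inj₂ ((_ , ¬a) , _)) a° → ¬a (proj₁ a°) }
            ; U∩R = λ { (inj₁ u) s → U∩R u (proj₁ (Z.sub i (S⊆Z s))) ; (inj₂ ((_ , ¬a) , _)) s → ¬a (Zs⊆A (S⊆Z s)) }
            ; W∩R = S∩A°
            ; connU = connected-∪ connU λ { d@(_ , y , (ry , w) , y~U) →
                y , conn-closed D-closed id d w , (ry , y , (ry , here) , y~U) , y~U }
            ; connW = A°-connected ; connR = S-connected
            ; attU = let y , s , b , q , e = S-touches-p i in y , s , b , inj₂ (subst D q p∈D) , e
            ; attW = S-touches-A° i
            ; spread = spread-mono
                (λ { _ (inj₁ (b , q , e)) → inj₁ (b , inj₂ (subst D q p∈D) , e) ; _ (inj₂ h) → inj₂ h }) (S-spread i) }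
        ; U⊆U′ = inj₁ ; U′⊆ = [ inj₁ , inj₂ ∘ proj₁ ∘ proj₁ ]′ ; P⊆R = A°⊆R
        ; attP = x , near⇒A° a (inj₂ x~W) , x~W
        ; Rs⊆R = proj₁ ∘ Z.sub _ ∘ S⊆Z ; disjoint = λ s s′ → disjoint (S⊆Z s) (S⊆Z s′) }
        where
        D : VSet
        D x = (R ─ A) x × ∃ λ y → Comp (R ─ A) [] x y × Att U y
        D-closed : ∀ {x y} → D x → Link (R ─ A) [] x y → D y
        D-closed (_ , z , (rz , w) , z~U) l@(_ , r , _) = r , z , (rz , step (link-sym l) w) , z~U
        p∈D : D p
        p∈D = (p∈R , λ a′ → proj₂ (A⊆X a′) refl) , bypass A-closed A≁U

    -- If infinitely many regions are attached to `U` or `W`, `attachedRegions` applies. Otherwise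
    -- the attached ones are discarded. Either the remaining regions meet infinitely many components
    -- of `R − p`, which are attached by `outlets` and serve as regions themselves, or infinitely
    -- many lie in one component `A`, and their hubs are used.
    wide-vertex : Att W p → (∀ {x} → X x → ∃ λ y → Comp X [] x y × Near U W y) → Rich {R} {p} X →
      Keep U W R ⊎ Move U W R
    wide-vertex p~W outlets rich
      with disjointRegions rich
    ... | Zs , regions , disjoint with infinitelyOften (λ i → ∃ λ x → Zs i x × Near U W x)
    ...   | inj₁ (f , inj , att) =
            attachedRegions σ p∈R p~W (Zs ∘ f) (regions ∘ f) (λ z z′ → inj _ _ (disjoint z z′)) att
    ...   | inj₂ (N , unattached) = unattached-case
          (infiniteClassOrTransversal (λ i j → Conn X [] (n i) (n j)) (λ _ → here) conn-sym)
      where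
      n : ℕ → Vertex
      n i = proj₁ (Region.touch (regions (N + i)))
      n∈Z : ∀ i → Zs (N + i) (n i)
      n∈Z i = proj₁ (proj₂ (Region.touch (regions (N + i))))
      n∈X : ∀ i → X (n i)
      n∈X i = Region.sub (regions (N + i)) (n∈Z i)
      unattached-case :
        (Σ ℕ λ i → Σ (ℕ → ℕ) λ f → Injective f × (∀ j → Conn X [] (n i) (n (f j)))) ⊎
        (Σ (ℕ → ℕ) λ f → ∀ i j → Conn X [] (n (f i)) (n (f j)) → i ≡ j) → Keep U W R ⊎ Move U W R
      unattached-case (inj₂ (f , transversal)) =
        attachedRegions σ p∈R p~W (λ i → Comp X [] (n (f i)))
          (λ i → component-region (n∈X (f i)) (proj₂ (proj₂ (Region.touch (regions (N + f i))))))
          (λ { (_ , w) (_ , w′) → transversal _ _ (w ◅◅ conn-sym w′) })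
          (λ i → outlets (n∈X (f i)))
      unattached-case (inj₁ (i , f , inj , w)) = inj₂ (choose (dec (∃ λ x → A x × Att U x)))
        where
        A : VSet
        A = Comp X [] (n i)
        A-closed : ∀ {x y} → A x → X y → x ∼ y → A y
        A-closed a x e = Comp-step a (proj₁ a , x , e , avoids-[])
        Zs⊆A : ∀ {j} → Zs (N + f j) ⊆ A
        Zs⊆A {j} z = Region.sub (regions (N + f j)) z
          , w j ◅◅ conn-⊆ (Region.sub (regions (N + f j))) (Region.connected (regions (N + f j)) (n∈Z (f j)) z)
        dis : Disjoint (λ j → Zs (N + f j))
        dis z z′ = inj _ _ (+-cancelˡ-≡ N _ _ (disjoint z z′))
        choose : Dec (∃ λ x → A x × Att U x) → Move U W R
        choose (yes A~U) = move-at-p proj₁ (Comp-connected (n∈X i)) A-closed (λ j → Zs (N + f j)) Zs⊆A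
          (λ j → regions (N + f j)) dis (λ {j} z near → unattached (N + f j) (m≤m+n N _) (_ , z , near)) p~W A~U
        choose (no A≁U) with outlets (n∈X i)
        ... | y , a , inj₁ y~U = ⊥-elim (A≁U (y , a , y~U))
        ... | y , a , inj₂ y~W = move-away-from-p proj₁ (Comp-connected (n∈X i)) A-closed (λ j → Zs (N + f j)) Zs⊆A
          (λ j → regions (N + f j)) dis (λ {j} z near → unattached (N + f j) (m≤m+n N _) (_ , z , near))
          (λ a′ u → A≁U (_ , a′ , u)) (y , a , y~W)

-- Outcomes of a state, and absorption of finite sets into its ends

module Outcomes (lem : ∀ {a} → ExcludedMiddle a) {ℓ : Level} (G : Graph ℓ) where
  open Classical lem
  open Connectivity lem G
  open Branching lem G

  Many : VSet → VSet → Vertex → Set ℓ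
  Many U R m = Infinite λ n → R n × Same R m n × Att U n

  -- The class of m modulo edge-inseparability in R is the middle of a football.
  record Core (U W R : VSet) (m : Vertex) : Set ℓ where
    field
      state : State U W R
      manyU : Many U R m
      manyW : Many W R m
      fewOut : ∀ {k} → R k → Same R m k → ∃ λ l → ∀ {n} → R n → k ∼ n → ¬ Same R m n → n ∈ l

  record Foot (U W R : VSet) : Set (lsuc ℓ) where
    field
      {U′ W′ R′} : VSet
      {m} : Vertex
      core : Core U′ W′ R′ m
      U⊆U′ : U ⊆ U′
      U′⊆ : U′ ⊆ U ∪ R
      W⊆W′ : W ⊆ W′
      W′⊆ : W′ ⊆ W ∪ R
      R′⊆R : R′ ⊆ R

  swapCore : ∀ {U W R m} → Core U W R m → Core W U R m
  swapCore c = record { state = swapState state ; manyU = manyW ; manyW = manyU ; fewOut = fewOut }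
    where open Core c

  -- The absorbed sets are recorded as finite lists because pulling an outcome back takes `Q` away
  -- from the second end, and a finite set meets only finitely many of the disjoint states.
  record Ext (U W R U′ W′ R′ : VSet) : Set ℓ where
    field
      P Q : List Vertex
      P⊆R : In P ⊆ R
      Q⊆R : In Q ⊆ R
      connP : Connected (In P)
      connQ : Connected (In Q)
      hookP : ∀ {x} → x ∈ P → ∃ λ y → y ∈ P × Att U y
      hookQ : ∀ {x} → x ∈ Q → ∃ λ y → y ∈ Q × Att W y
      U⊆U′ : U ⊆ U′
      P⊆U′ : In P ⊆ U′
      U′⊆ : U′ ⊆ U ∪ In P
      W⊆W′ : W ⊆ W′
      Q⊆W′ : In Q ⊆ W′
      W′⊆ : W′ ⊆ W ∪ In Q
      R′⊆R : R′ ⊆ R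

  swapExt : ∀ {U W R U′ W′ R′} → Ext U W R U′ W′ R′ → Ext W U R W′ U′ R′
  swapExt e = record
    { P = Q ; Q = P ; P⊆R = Q⊆R ; Q⊆R = P⊆R ; connP = connQ ; connQ = connP ; hookP = hookQ ; hookQ = hookP
    ; U⊆U′ = W⊆W′ ; P⊆U′ = Q⊆W′ ; U′⊆ = W′⊆ ; W⊆W′ = U⊆U′ ; Q⊆W′ = P⊆U′ ; W′⊆ = U′⊆ ; R′⊆R = R′⊆R }
    where open Ext e

  Outcome : VSet → VSet → VSet → Set (lsuc ℓ)
  Outcome U W R = Foot U W R ⊎ (Keep U W R ⊎ Move U W R)

  att-⊆ : ∀ {S T x} → S ⊆ T → Att S x → Att T x
  att-⊆ sub (y , s , e) = y , sub s , e

  att-∪ : ∀ {S T x} → Att (S ∪ T) x → Att S x ⊎ Att T x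
  att-∪ (y , inj₁ s , e) = inj₁ (y , s , e)
  att-∪ (y , inj₂ t , e) = inj₂ (y , t , e)

  connected-meet : ∀ {S T p} → Connected S → Connected T → S p → T p → Connected (S ∪ T)
  connected-meet {S} {T} {p} cS cT s t x y = to-p x ◅◅ conn-sym (to-p y)
    where
    to-p : ∀ {x} → (S ∪ T) x → Conn (S ∪ T) [] x p
    to-p (inj₁ x) = conn-⊆ inj₁ (cS x s)
    to-p (inj₂ x) = conn-⊆ inj₂ (cT x t)

  hull : ∀ {R p} Q → Connected R → R p → In Q ⊆ R → Connected (In Q) →
    ∃ λ T → In T ⊆ R × p ∈ T × In Q ⊆ In T × Connected (In T)
  hull {p = p} [] cR r sub cQ = p ∷ [] , (λ { (here refl) → r }) , here refl , (λ ())
    , λ { (here refl) (here refl) → here }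
  hull (q ∷ Q) cR r sub cQ with finiteWalk r (cR r (sub (here refl)))
  ... | l , l⊆R , p∈l , q∈l , c = (q ∷ Q) ++ l , (λ i → [ sub , l⊆R ]′ (∈-++⁻ (q ∷ Q) i)) , ∈-++⁺ʳ (q ∷ Q) p∈l
    , ∈-++⁺ˡ , λ i j → conn-⊆ [ ∈-++⁺ˡ , ∈-++⁺ʳ (q ∷ Q) ]′
        (connected-meet cQ (connected-In c) (here refl) q∈l (∈-++⁻ (q ∷ Q) i) (∈-++⁻ (q ∷ Q) j))

  module _ {U W R U′ W′ R′ : VSet} (σ : State U W R) (τ : State U′ W′ R′) (ext : Ext U W R U′ W′ R′) where
    open Ext ext
    private
      module σ = State σ
      module τ = State τ

      U′⊆U∪R : U′ ⊆ U ∪ R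
      U′⊆U∪R u = [ inj₁ , inj₂ ∘ P⊆R ]′ (U′⊆ u)
      W′⊆W∪R : W′ ⊆ W ∪ R
      W′⊆W∪R w = [ inj₁ , inj₂ ∘ Q⊆R ]′ (W′⊆ w)

    foot-up : Foot U′ W′ R′ → Foot U W R
    foot-up f = record
      { core = F.core ; U⊆U′ = F.U⊆U′ ∘ U⊆U′ ; U′⊆ = λ u → [ U′⊆U∪R , inj₂ ∘ R′⊆R ]′ (F.U′⊆ u)
      ; W⊆W′ = F.W⊆W′ ∘ W⊆W′ ; W′⊆ = λ w → [ W′⊆W∪R , inj₂ ∘ R′⊆R ]′ (F.W′⊆ w) ; R′⊆R = R′⊆R ∘ F.R′⊆R }
      where module F = Foot f

    -- The given states end in `W ∪ Q`, but a `Keep` must end in exactly `W`. If infinitely many of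
    -- them touch `W`, then `Q` is moved to the first end, joined to `p` by the finite set `T`.
    -- Otherwise almost all touch the second end only in `Q`, and `Q` itself serves as the `P` of a
    -- `Move`.
    keep-up : Keep U′ W′ R′ → Keep U W R ⊎ Move U W R
    keep-up k with infinitelyOften (λ i → ∃ λ x → Keep.Rs k i x × Att W x)
    ... | inj₁ (f , inj , att) = inj₁ record
          { states = λ i → record
              { U∩W = [ (λ u w → State.U∩W (K.states i) u (W⊆W′ w)) , (λ t w → σ.W∩R w (T⊆R t)) ]′
              ; U∩R = [ State.U∩R (K.states _) , avoid i ]′
              ; W∩R = State.W∩R (K.states _) ∘ W⊆W′
              ; connU = connected-meet (State.connU (K.states i)) T-connected K.p∈U′ p∈T
              ; connW = σ.connW ; connR = State.connR (K.states _)
              ; attU = let x , r , a = State.attU (K.states (f (N + i))) in x , r , att-⊆ inj₁ a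
              ; attW = att (N + i)
              ; spread = spread-mono
                  (λ { _ (inj₁ u) → inj₁ (att-⊆ inj₁ u)
                     ; _ (inj₂ w) → [ inj₂ , inj₁ ∘ att-⊆ (inj₂ ∘ Q⊆T) ]′ (att-∪ (att-⊆ W′⊆ w)) })
                  (State.spread (K.states _)) }
          ; U⊆U′ = inj₁ ∘ K.U⊆U′ ∘ U⊆U′
          ; U′⊆ = [ (λ u → [ U′⊆U∪R , inj₂ ∘ R′⊆R ]′ (K.U′⊆ u)) , inj₂ ∘ T⊆R ]′
          ; p∈U′ = inj₁ K.p∈U′ ; p∈R = R′⊆R K.p∈R ; Rs⊆R = R′⊆R ∘ K.Rs⊆R
          ; disjoint = λ r r′ → +-cancelˡ-≡ N _ _ (inj _ _ (K.disjoint r r′)) ; touch = λ i → K.touch _ }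
      where
      module K = Keep k
      T-hull = hull Q σ.connR (R′⊆R K.p∈R) Q⊆R connQ
      T = proj₁ T-hull
      T⊆R = proj₁ (proj₂ T-hull)
      p∈T = proj₁ (proj₂ (proj₂ T-hull))
      Q⊆T = proj₁ (proj₂ (proj₂ (proj₂ T-hull)))
      T-connected = proj₂ (proj₂ (proj₂ (proj₂ T-hull)))
      late = avoidsEventually {K.Rs ∘ f} (λ r r′ → inj _ _ (K.disjoint r r′)) T
      N = proj₁ late
      avoid = proj₂ late
    ... | inj₂ (N , unattached) = inj₂ record
          { states = λ i → record
              { U∩W = λ u q → State.U∩W (K.states i) u (Q⊆W′ q)
              ; U∩R = State.U∩R (K.states _) ; W∩R = State.W∩R (K.states _) ∘ Q⊆W′
              ; connU = State.connU (K.states i) ; connW = connQ ; connR = State.connR (K.states _)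
              ; attU = State.attU (K.states _) ; attW = attQ i
              ; spread = spread-mono
                  (λ { _ (inj₁ u) → inj₁ u ; r (inj₂ w) → inj₂ (only-Q i r w) }) (State.spread (K.states _)) }
          ; U⊆U′ = K.U⊆U′ ∘ U⊆U′ ; U′⊆ = λ u → [ U′⊆U∪R , inj₂ ∘ R′⊆R ]′ (K.U′⊆ u)
          ; P⊆R = Q⊆R ; attP = hookQ (proj₁ (proj₂ (proj₂ (proj₂ (attQ 0)))))
          ; Rs⊆R = R′⊆R ∘ K.Rs⊆R ; disjoint = λ r r′ → +-cancelˡ-≡ N _ _ (K.disjoint r r′) }
      where
      module K = Keep k
      only-Q : ∀ i {x} → K.Rs (N + i) x → Att W′ x → Att (In Q) x
      only-Q i r w = [ (λ a → ⊥-elim (unattached (N + i) (m≤m+n N i) (_ , r , a))) , id ]′ (att-∪ (att-⊆ W′⊆ w))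
      attQ : ∀ i → ∃ λ x → K.Rs (N + i) x × Att (In Q) x
      attQ i = let x , r , a = State.attW (K.states (N + i)) in x , r , only-Q i r a

    -- The new end `P` is attached to `W` or to `Q`. In the latter case `P ∪ Q` takes its place,
    -- since `Q` is attached to `W`.
    move-up : Move U′ W′ R′ → Move U W R
    move-up m with Move.attP m
    ... | x , px , w with att-∪ (att-⊆ W′⊆ w)
    ...   | inj₁ x~W = record
            { states = M.states ; U⊆U′ = M.U⊆U′ ∘ U⊆U′ ; U′⊆ = λ u → [ U′⊆U∪R , inj₂ ∘ R′⊆R ]′ (M.U′⊆ u)
            ; P⊆R = R′⊆R ∘ M.P⊆R ; attP = x , px , x~W ; Rs⊆R = R′⊆R ∘ M.Rs⊆R ; disjoint = M.disjoint }
      where module M = Move m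
    ...   | inj₂ x~Q@(q , q∈Q , _) = record
            { states = λ i → record
                { U∩W = λ { u (inj₁ p) → State.U∩W (M.states i) u p
                          ; u (inj₂ q′) → [ (λ u′ → τ.U∩W u′ (Q⊆W′ q′)) , τ.W∩R (Q⊆W′ q′) ]′ (M.U′⊆ u) }
                ; U∩R = State.U∩R (M.states i)
                ; W∩R = λ { (inj₁ p) → State.W∩R (M.states i) p ; (inj₂ q′) r → τ.W∩R (Q⊆W′ q′) (M.Rs⊆R r) }
                ; connU = State.connU (M.states i)
                ; connW = λ a b → conn-⊆ swap
                    (connected-∪-touch connQ (State.connW (M.states i)) (x , px , x~Q) (swap a) (swap b))
                ; connR = State.connR (M.states i) ; attU = State.attU (M.states i)
                ; attW = let y , r , a = State.attW (M.states i) in y , r , att-⊆ inj₁ a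
                ; spread = spread-mono (λ { _ (inj₁ u) → inj₁ u ; _ (inj₂ p) → inj₂ (att-⊆ inj₁ p) })
                    (State.spread (M.states i)) }
            ; U⊆U′ = M.U⊆U′ ∘ U⊆U′ ; U′⊆ = λ u → [ U′⊆U∪R , inj₂ ∘ R′⊆R ]′ (M.U′⊆ u)
            ; P⊆R = [ R′⊆R ∘ M.P⊆R , Q⊆R ]′
            ; attP = let y , y∈Q , a = hookQ q∈Q in y , inj₂ y∈Q , a
            ; Rs⊆R = R′⊆R ∘ M.Rs⊆R ; disjoint = M.disjoint }
      where
      module M = Move m

    outcome-up : Outcome U′ W′ R′ → Outcome U W R
    outcome-up (inj₁ f) = inj₁ (foot-up f)
    outcome-up (inj₂ (inj₁ k)) = inj₂ (keep-up k)
    outcome-up (inj₂ (inj₂ m)) = inj₂ (inj₂ (move-up m))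

-- Robust vertices and paths between the two ends

module Cleaning (lem : ∀ {a} → ExcludedMiddle a) {ℓ : Level} (G : Graph ℓ) where
  open Classical lem
  open Connectivity lem G
  open Branching lem G
  open Cutting lem G
  open WideVertex lem G
  open Outcomes lem G

  module _ (N R : VSet) where

    Outlet : Vertex → VSet
    Outlet s x = ∃ λ z → Comp (R ─ ｛ s ｝) [] x z × N z

    -- A vertex which a single `s` separates from the ends lies on no path between them. Discarding
    -- all such vertices costs no connectivity among the others, see `shortcut`.
    Robust : VSet
    Robust x = R x × (∀ s → s ≢ x → Outlet s x)

    near⇒robust : ∀ {x} → R x → N x → Robust x
    near⇒robust r n = r , λ s s≢x → _ , ((r , s≢x) , here) , n

    outlet-step : ∀ {s x y} → R x → s ≢ x → R y → s ≢ y → x ∼ y → Outlet s y → Outlet s x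
    outlet-step r s≢x r′ s≢y e (z , (q , w) , n) =
      z , (q , step ((r , s≢x) , (r′ , s≢y) , e , avoids-[]) w) , n

    -- A walk which leaves the robust vertices at s has to come back through s.
    shortcut : ∀ {S F c y} → S ⊆ R → Conn S F c y → Robust y →
      (Robust c → Conn (λ x → S x × Robust x) F c y) ×
      (∀ {s} → S s → Robust s → s ≢ c → ¬ Outlet s c → Conn (λ x → S x × Robust x) F s y)
    shortcut S⊆R here (_ , out) = (λ _ → here) , λ _ _ s≢c ¬o → ⊥-elim (¬o (out _ s≢c))
    shortcut {S} {F} S⊆R (step {c} {c′} (sc , sc′ , e , o) w) rob-y with shortcut S⊆R w rob-y
    ... | from-robust , from-separator = robust-case , separated-case
      where
      robust-case : Robust c → _
      robust-case rob with dec (Robust c′)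
      ... | yes rob′ = step ((sc , rob) , (sc′ , rob′) , e , o) (from-robust rob′)
      ... | no ¬rob′ with ¬∀⇒∃¬ (λ h → ¬rob′ (S⊆R sc′ , h))
      ...   | s , h with dec (s ≡ c) | ¬∀⇒∃¬ h
      ...     | yes refl | s≢c′ , ¬out = from-separator sc rob s≢c′ ¬out
      ...     | no s≢c | s≢c′ , ¬out =
                ⊥-elim (¬out (outlet-step (S⊆R sc′) s≢c′ (S⊆R sc) s≢c (∼-sym e) (proj₂ rob s s≢c)))
      separated-case : ∀ {s} → S s → Robust s → s ≢ c → ¬ Outlet s c → _
      separated-case {s} ss rob-s s≢c ¬out with dec (s ≡ c′)
      ... | yes refl = from-robust rob-s
      ... | no s≢c′ = from-separator ss rob-s s≢c′
              λ out → ¬out (outlet-step (S⊆R sc) s≢c (S⊆R sc′) s≢c′ e out)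

    robust-conn : ∀ {S F x y} → S ⊆ R → Robust x → Robust y → Conn S F x y → Conn (λ z → S z × Robust z) F x y
    robust-conn S⊆R x y w = proj₁ (shortcut S⊆R w y) x

  Clean : VSet → VSet → VSet → Set ℓ
  Clean U W R = ∀ {x s} → R x → s ≢ x → Outlet (Near U W) R s x

  module _ {U W R : VSet} (σ : State U W R) where
    open State σ

    R° : VSet
    R° = Robust (Near U W) R

    robust-same : ∀ {x y} → R° x → R° y → Same R x y → Same R° x y
    robust-same x y h F = conn-⊆ proj₂ (robust-conn _ _ id x y (h F))

    cleanState : State U W R°
    cleanState = record
      { U∩W = U∩W ; U∩R = λ u → U∩R u ∘ proj₁ ; W∩R = λ w → W∩R w ∘ proj₁
      ; connU = connU ; connW = connW
      ; connR = λ x y → conn-⊆ proj₂ (robust-conn _ _ id x y (connR (proj₁ x) (proj₁ y)))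
      ; attU = let x , r , a = attU in x , near⇒robust _ _ r (inj₁ a) , a
      ; attW = let x , r , a = attW in x , near⇒robust _ _ r (inj₂ a) , a
      ; spread = λ x F L → let y , (r , w) , y∉L , n = spread (proj₁ x) F L
                               y° = near⇒robust _ _ r n
                           in y , (y° , conn-⊆ proj₂ (robust-conn _ _ id x y° w)) , y∉L , n }

    clean : Clean U W R°
    clean {s = s} x s≢x with proj₂ x s s≢x
    ... | z , ((r , s≢z) , w) , n =
      z , ((z° , s≢z) , conn-⊆ (λ { ((_ , ≢) , q) → q , ≢ }) (robust-conn _ _ proj₁ x z° w)) , n
      where z° = near⇒robust _ _ r n

    cleanExt : Ext U W R U W R°
    cleanExt = record
      { P = [] ; Q = [] ; P⊆R = λ () ; Q⊆R = λ () ; connP = λ () ; connQ = λ () ; hookP = λ () ; hookQ = λ ()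
      ; U⊆U′ = id ; P⊆U′ = λ () ; U′⊆ = inj₁ ; W⊆W′ = id ; Q⊆W′ = λ () ; W′⊆ = inj₁ ; R′⊆R = proj₁ }

  -- This stands for a path from `x` to `U`. Allowing any set in which every vertex reaches `U`
  -- avoids the bookkeeping of paths; `finiteArm` extracts a finite piece at the end.
  record Arm (U A : VSet) (x : Vertex) : Set ℓ where
    field
      away : ¬ A x
      reach : ∀ {a} → A a → ∃ λ y → Comp A [] a y × Att U y
      base : Att (U ∪ A) x
  open Arm

  -- After its last visit to `x`, the walk stays in the part of `S − x` that reaches `U` without
  -- `x`; this part is the arm.
  armWithin : ∀ {U S x y} → S x → Conn S [] x y → Att U y → ∃ λ A → A ⊆ S × Arm U A x
  armWithin {U} {S} {x} sx w y~U = A , (λ { (a , _) → proj₁ a }) , record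
    { away = λ { ((_ , x≢x) , _) → x≢x refl }
    ; reach = λ { a@(_ , y , (_ , w′) , y~U) →
        y , (conn-end a (walkIn a w′) , walkIn a w′) , y~U }
    ; base = [ id , (λ { ((_ , x≢x) , _) → ⊥-elim (x≢x refl) }) ]′ (go sx w y~U) }
    where
    A : VSet
    A a = (S ─ ｛ x ｝) a × ∃ λ y → Comp (S ─ ｛ x ｝) [] a y × Att U y
    A-step : ∀ {a b} → A a → Link (S ─ ｛ x ｝) [] a b → A b
    A-step (_ , z , (sz , w) , z~U) l@(_ , b , _) = b , z , (sz , step (link-sym l) w) , z~U
    walkIn : ∀ {a b} → A a → Conn (S ─ ｛ x ｝) [] a b → Conn A [] a b
    walkIn = conn-closed A-step id
    go : ∀ {c y} → S c → Conn S [] c y → Att U y → Att (U ∪ A) x ⊎ A c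
    go {c} sc here y~U with dec (x ≡ c)
    ... | yes refl = inj₁ (att-⊆ inj₁ y~U)
    ... | no x≢c = inj₂ ((sc , x≢c) , c , ((sc , x≢c) , here) , y~U)
    go {c} sc (step {y = c′} (_ , sc′ , e , _) w) y~U with go sc′ w y~U
    ... | inj₁ a = inj₁ a
    ... | inj₂ a with dec (x ≡ c)
    ...   | yes refl = inj₁ (c′ , inj₂ a , e)
    ...   | no x≢c = inj₂ (A-step a (proj₁ a , (sc , x≢c) , ∼-sym e , avoids-[]))

  armExtend : ∀ {W B x x′} → Arm W B x′ → x ∼ x′ → ¬ B x → Arm W (B ∪ ｛ x′ ｝) x
  armExtend {W} {B} {x} {x′} arm e ¬b = record
    { away = [ ¬b , (λ { refl → ∼⇒≢ e refl }) ]′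
    ; reach = λ { (inj₁ b) → lift (reach arm b) ; (inj₂ refl) → root }
    ; base = x′ , inj₂ (inj₂ refl) , e }
    where
    lift : ∀ {b} → (∃ λ y → Comp B [] b y × Att W y) → ∃ λ y → Comp (B ∪ ｛ x′ ｝) [] b y × Att W y
    lift (y , (b , w) , a) = y , (inj₁ b , conn-⊆ inj₁ w) , a
    root : ∃ λ y → Comp (B ∪ ｛ x′ ｝) [] x′ y × Att W y
    root with base arm
    ... | y , inj₁ wy , e′ = x′ , (inj₂ refl , here) , y , wy , e′
    ... | b , inj₂ bb , e′ with lift (reach arm bb)
    ...   | y , (by , w) , a = y , (by , step (inj₂ refl , inj₁ bb , e′ , avoids-[]) w) , a

  record OnPath (U W R : VSet) (x : Vertex) : Set (lsuc ℓ) where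
    field
      {A B} : VSet
      A⊆R : A ⊆ R
      B⊆R : B ⊆ R
      A∩B : ∀ {y} → A y → ¬ B y
      armU : Arm U A x
      armW : Arm W B x

  swapPath : ∀ {U W R x} → OnPath U W R x → OnPath W U R x
  swapPath o = record { A⊆R = B⊆R ; B⊆R = A⊆R ; A∩B = λ b a → A∩B a b ; armU = armW ; armW = armU }
    where open OnPath o

  pathFromEnd : ∀ {U W R x} → State U W R → R x → Att U x → OnPath U W R x
  pathFromEnd {U} {x = x} σ r (u , uu , e) with armWithin r (connR r (proj₁ (proj₂ attW))) (proj₂ (proj₂ attW))
    where open State σ
  ... | B , B⊆R , arm = record
    { A = λ _ → U u × ¬ U u ; A⊆R = λ (p , q) → ⊥-elim (q p) ; B⊆R = B⊆R ; A∩B = λ (p , q) → ⊥-elim (q p)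
    ; armU = record { away = λ (p , q) → q p ; reach = λ (p , q) → ⊥-elim (q p) ; base = u , inj₁ uu , e }
    ; armW = arm }

  -- x′ ∼ x lies on a path; x is inserted on the U-side.
  pathThrough : ∀ {U W R x x′} (o : OnPath U W R x′) → x ∼ x′ → R x′ → let open OnPath o in
    ∀ {S : VSet} {y} → S ⊆ R → (∀ {z} → S z → ¬ B z × x′ ≢ z) → S x → Conn S [] x y → Att U y → OnPath U W R x
  pathThrough o e r S⊆R apart sx w y~U with armWithin sx w y~U
  ... | A , A⊆S , arm = record
    { A⊆R = S⊆R ∘ A⊆S ; B⊆R = [ B⊆R , (λ { refl → r }) ]′
    ; A∩B = λ { a (inj₁ b) → proj₁ (apart (A⊆S a)) b ; a (inj₂ refl) → proj₂ (apart (A⊆S a)) refl }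
    ; armU = arm ; armW = armExtend armW e (proj₁ (apart sx)) }
    where open OnPath o

  module _ {U W R : VSet} (σ : State U W R) (cl : Clean U W R) where
    open State σ

    -- Induction along a walk from `x` to the ends: the next vertex `x′` lies on a path. If `x` is
    -- on one of its arms, that arm is cut at `x`. If not, cleanness gives a walk from `x` that
    -- avoids `x′`. It is followed until it meets an arm or reaches an end, and the new path goes
    -- from there through `x` and `x′` to the other end.
    onPath : ∀ {x y} → R x → Conn R [] x y → Near U W y → OnPath U W R x
    onPath r here (inj₁ y~U) = pathFromEnd σ r y~U
    onPath r here (inj₂ y~W) = swapPath (pathFromEnd (swapState σ) r y~W)
    onPath {x} r (step {y = x′} (_ , r′ , e , _) w) near with onPath r′ w near
    ... | o with dec (OnPath.A o x) | dec (OnPath.B o x)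
    ...   | yes a | _ = let y , (_ , w′) , y~U = reach armU a in
              pathThrough o e r′ A⊆R (λ z → A∩B z , λ { refl → away armU z }) a w′ y~U
      where open OnPath o
    ...   | no _ | yes b = let y , (_ , w′) , y~W = reach armW b in
              swapPath (pathThrough (swapPath o) e r′ B⊆R (λ z → (λ a → A∩B a z) , λ { refl → away armW z }) b w′ y~W)
      where open OnPath o
    ...   | no ¬a | no ¬b = extend (cl r (∼⇒≢ (∼-sym e)))
      where
      open OnPath o
      T S : VSet
      T = A ∪ B
      S = R ─ ｛ x′ ｝ ─ T
      S⊆R : S ⊆ R
      S⊆R ((s , _) , _) = s
      ¬t = [ ¬a , ¬b ]′
      viaU : ∀ {z} → Comp S [] x z → Att (U ∪ A) z → OnPath U W R x
      viaU (sz , c) (u , inj₁ uu , e′) = pathThrough o e r′ S⊆R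
        (λ { ((_ , ≢) , ¬t′) → ¬t′ ∘ inj₂ , ≢ }) ((r , ∼⇒≢ (∼-sym e)) , ¬t) c (u , uu , e′)
      viaU (sz , c) (a , inj₂ aa , e′) = let y , (_ , w′) , y~U = reach armU aa in
        pathThrough o e r′ {S = A ∪ S} [ A⊆R , S⊆R ]′
          [ (λ z → A∩B z , λ { refl → away armU z }) , (λ { ((_ , ≢) , ¬t′) → ¬t′ ∘ inj₂ , ≢ }) ]′
          (inj₂ ((r , ∼⇒≢ (∼-sym e)) , ¬t))
          (conn-⊆ inj₂ c ◅◅ step (inj₂ sz , inj₁ aa , e′ , avoids-[]) (conn-⊆ inj₁ w′)) y~U
      viaW : ∀ {z} → Comp S [] x z → Att (W ∪ B) z → OnPath U W R x
      viaW (sz , c) (u , inj₁ uu , e′) = swapPath (pathThrough (swapPath o) e r′ S⊆R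
        (λ { ((_ , ≢) , ¬t′) → ¬t′ ∘ inj₁ , ≢ }) ((r , ∼⇒≢ (∼-sym e)) , ¬t) c (u , uu , e′))
      viaW (sz , c) (b , inj₂ bb , e′) = let y , (_ , w′) , y~W = reach armW bb in
        swapPath (pathThrough (swapPath o) e r′ {S = B ∪ S} [ B⊆R , S⊆R ]′
          [ (λ z → (λ a → A∩B a z) , λ { refl → away armW z }) , (λ { ((_ , ≢) , ¬t′) → ¬t′ ∘ inj₁ , ≢ }) ]′
          (inj₂ ((r , ∼⇒≢ (∼-sym e)) , ¬t))
          (conn-⊆ inj₂ c ◅◅ step (inj₂ sz , inj₁ bb , e′ , avoids-[]) (conn-⊆ inj₁ w′)) y~W)
      extend : Outlet (Near U W) R x′ x → OnPath U W R x
      extend (z , (rz , c) , n) with hitOrAvoid T (r , ∼⇒≢ (∼-sym e)) ¬t c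
      ... | inj₁ (z′ , t , c′ , _ , inj₁ a , e′ , _) = viaU c′ (t , inj₂ a , e′)
      ... | inj₁ (z′ , t , c′ , _ , inj₂ b , e′ , _) = viaW c′ (t , inj₂ b , e′)
      ... | inj₂ (¬tz , c′) with n
      ...   | inj₁ a = viaU ((rz , ¬tz) , c′) (att-⊆ inj₁ a)
      ...   | inj₂ a = viaW ((rz , ¬tz) , c′) (att-⊆ inj₁ a)

  finiteArm : ∀ {U A x} → Arm U A x → ∃ λ l → In l ⊆ A × Connected (In l) ×
    (∀ {z} → z ∈ l → ∃ λ y → y ∈ l × Att U y) × Att (U ∪ In l) x
  finiteArm arm with base arm
  ... | u , inj₁ uu , e = [] , (λ ()) , (λ ()) , (λ ()) , u , inj₁ uu , e
  ... | a , inj₂ aa , e with reach arm aa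
  ...   | y , (_ , w) , y~U with finiteWalk aa w
  ...     | l , l⊆A , a∈l , y∈l , c =
              l , l⊆A , connected-In c , (λ _ → y , y∈l , y~U) , a , inj₂ a∈l , e

  Star : VSet → Vertex → Set ℓ
  Star R k = ∃ λ l → ∀ {n} → (R ─ ｛ k ｝) n → n ∼ k → ∃ λ m → m ∈ l × Same (R ─ ｛ k ｝) m n

  module _ {U W R : VSet} (σ : State U W R) (cl : Clean U W R) {k : Vertex} (k∈R : R k) where
    open State σ

    -- The two finite arms of a path through `k` are absorbed, which makes `k` adjacent to both
    -- ends. If `k` sees infinitely many classes, it still does so afterwards, and `wide-vertex`
    -- applies.
    starOrOutcome : Star R k ⊎ Outcome U W R
    starOrOutcome with dec (Star R k)
    ... | yes s = inj₁ s
    ... | no ¬star = inj₂ (outcome-up σ τ ext (inj₂ (wide-vertex τ k∈R′ k~W outlets rich)))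
      where
      o : OnPath U W R k
      o = let y , r , a = attU in onPath σ cl k∈R (connR k∈R r) (inj₁ a)
      open OnPath o
      armP = finiteArm armU
      armQ = finiteArm armW
      P Q bl : List Vertex
      P = proj₁ armP
      Q = proj₁ armQ
      bl = P ++ Q
      P⊆A : In P ⊆ A
      P⊆A = proj₁ (proj₂ armP)
      Q⊆B : In Q ⊆ B
      Q⊆B = proj₁ (proj₂ armQ)
      hookP = proj₁ (proj₂ (proj₂ (proj₂ armP)))
      hookQ = proj₁ (proj₂ (proj₂ (proj₂ armQ)))
      U′ W′ R′ : VSet
      U′ = U ∪ In P
      W′ = W ∪ In Q
      R′ = Comp (R ─ In bl) [] k
      k∈ : (R ─ In bl) k
      k∈ = k∈R , λ i → [ away armU ∘ P⊆A , away armW ∘ Q⊆B ]′ (∈-++⁻ P i)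
      k∈R′ : R′ k
      k∈R′ = k∈ , here
      near-bl : ∀ {y} → Att (In bl) y → Near U′ W′ y
      near-bl (b , i , e) = [ (λ p → inj₁ (b , inj₂ p , e)) , (λ q → inj₂ (b , inj₂ q , e)) ]′ (∈-++⁻ P i)
      near-⊆ : ∀ {y} → Near U W y → Near U′ W′ y
      near-⊆ = [ inj₁ ∘ att-⊆ inj₁ , inj₂ ∘ att-⊆ inj₁ ]′
      k~W : Att W′ k
      k~W = proj₂ (proj₂ (proj₂ (proj₂ armQ)))
      connect : ∀ {Z l} → Connected Z → Connected (In l) → (∀ {z} → z ∈ l → ∃ λ y → y ∈ l × Att Z y) →
        Connected (Z ∪ In l)
      connect cZ cl′ hook = connected-∪ cZ λ i → let y , j , a = hook i in y , cl′ i j , j , a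
      τ : State U′ W′ R′
      τ = record
        { U∩W = λ { (inj₁ u) (inj₁ w) → U∩W u w ; (inj₁ u) (inj₂ q) → U∩R u (B⊆R (Q⊆B q))
                  ; (inj₂ p) (inj₁ w) → W∩R w (A⊆R (P⊆A p)) ; (inj₂ p) (inj₂ q) → A∩B (P⊆A p) (Q⊆B q) }
        ; U∩R = λ { (inj₁ u) ((r , _) , _) → U∩R u r ; (inj₂ p) ((_ , ∉) , _) → ∉ (∈-++⁺ˡ p) }
        ; W∩R = λ { (inj₁ w) ((r , _) , _) → W∩R w r ; (inj₂ q) ((_ , ∉) , _) → ∉ (∈-++⁺ʳ P q) }
        ; connU = connect connU (proj₁ (proj₂ (proj₂ armP))) hookP
        ; connW = connect connW (proj₁ (proj₂ (proj₂ armQ))) hookQ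
        ; connR = Comp-connected k∈
        ; attU = k , k∈R′ , proj₂ (proj₂ (proj₂ (proj₂ armP)))
        ; attW = k , k∈R′ , k~W
        ; spread = spread-mono (λ _ → [ near-⊆ , near-bl ]′)
            (spread-restrict spread (λ { ((r , _) , _) → r }) [] bl
              λ c r e _ ∉ → Comp-step c (proj₁ c , (r , ∉) , e , avoids-[])) }
      ext : Ext U W R U′ W′ R′
      ext = record
        { P = P ; Q = Q ; P⊆R = A⊆R ∘ P⊆A ; Q⊆R = B⊆R ∘ Q⊆B
        ; connP = proj₁ (proj₂ (proj₂ armP)) ; connQ = proj₁ (proj₂ (proj₂ armQ)) ; hookP = hookP ; hookQ = hookQ
        ; U⊆U′ = inj₁ ; P⊆U′ = inj₂ ; U′⊆ = id ; W⊆W′ = inj₁ ; Q⊆W′ = inj₂ ; W′⊆ = id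
        ; R′⊆R = λ { ((r , _) , _) → r } }
      stay : ∀ {x y} → (R′ ─ ｛ k ｝) x → Conn (R ─ ｛ k ｝ ─ In bl) [] x y → Comp (R′ ─ ｛ k ｝) [] x y
      stay x∈ w = conn-end x∈ w′ , w′
        where
        w′ = conn-closed (λ { (q , _) (_ , ((r , ≢) , ∉) , e , _) →
          Comp-step q (proj₁ q , (r , ∉) , e , avoids-[]) , ≢ }) id x∈ w
      outlets : ∀ {x} → (R′ ─ ｛ k ｝) x → ∃ λ y → Comp (R′ ─ ｛ k ｝) [] x y × Near U′ W′ y
      outlets {x} x∈@(((r , ∉bl) , _) , k≢x) with cl r k≢x
      ... | z , (rz , c) , n with hitOrAvoid (In bl) (r , k≢x) ∉bl c
      ...   | inj₁ (z′ , t , (_ , c′) , _ , i , e , _) = z′ , stay x∈ c′ , near-bl (t , i , e)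
      ...   | inj₂ (_ , c′) = z , stay x∈ c′ , near-⊆ n
      rich : Rich {R′} {k} (R′ ─ ｛ k ｝)
      -- Adding `bl` to the list makes the new neighbour avoid the absorbed vertices, since it is
      -- equivalent to itself.
      rich l with dec (∃ λ n → (R ─ ｛ k ｝) n × n ∼ k × ¬ (∃ λ m → m ∈ l ++ bl × Same (R ─ ｛ k ｝) m n))
      ... | no h = ⊥-elim (¬star (l ++ bl , λ n∈ e → dne λ ¬m → h (_ , n∈ , e , ¬m)))
      ... | yes (n , (r , k≢n) , e , new) =
        n , (Comp-step k∈R′ (k∈ , (r , ∉bl) , ∼-sym e , avoids-[]) , k≢n) , e
          , λ i h → new (_ , ∈-++⁺ˡ i , λ F → conn-⊆ (λ { (((q , _) , _) , ≢) → q , ≢ }) (h F))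
        where
        ∉bl : ¬ n ∈ bl
        ∉bl i = new (n , ∈-++⁺ʳ l i , λ _ → here)

-- Finding a class with infinitely many neighbours of both ends

module FootballSearch (lem : ∀ {a} → ExcludedMiddle a) {ℓ : Level} (G : Graph ℓ) where
  open Classical lem
  open Connectivity lem G
  open Branching lem G
  open Outcomes lem G
  open Cleaning lem G
  open WideVertex lem G using (bypass)

  -- What the search for a football uses of Outcome; unlike Outcome it is symmetric in the two ends.
  record Closed (Γ : VSet → VSet → VSet → Set (lsuc ℓ)) : Set (lsuc ℓ) where
    field
      up : ∀ {U W R U′ W′ R′} → State U W R → State U′ W′ R′ → Ext U W R U′ W′ R′ → Γ U′ W′ R′ → Γ U W R
      star : ∀ {U W R k} → State U W R → Clean U W R → R k → Star R k ⊎ Γ U W R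
      core : ∀ {U W R m} → Core U W R m → Γ U W R

  closed-Outcome : Closed Outcome
  closed-Outcome = record { up = outcome-up ; star = λ σ cl r → starOrOutcome σ cl r
    ; core = λ c → inj₁ record
        { core = c ; U⊆U′ = id ; U′⊆ = inj₁ ; W⊆W′ = id ; W′⊆ = inj₁ ; R′⊆R = id } }

  closed-swap : ∀ {Γ} → Closed Γ → Closed (λ U W R → Γ W U R)
  closed-swap c = record
    { up = λ σ τ e → up (swapState σ) (swapState τ) (swapExt e)
    ; star = λ σ cl → star (swapState σ) λ r s≢x → let z , q , n = cl r s≢x in z , q , swap n
    ; core = core ∘ swapCore }
    where open Closed c

  -- Infinitely many neighbours of `k` outside its class would include infinitely many from one
  -- class of `R − k`. Finitely many edges cannot separate `k` from that class, so it would belong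
  -- to the class of `k` after all.
  fewOutside : ∀ {R k} → R k → Star R k → ∃ λ l → ∀ {n} → R n → k ∼ n → ¬ Same R k n → n ∈ l
  fewOutside {R} {k} k∈R (reps , cover)
    with dec (∃ λ l → ∀ {n} → R n → k ∼ n → ¬ Same R k n → n ∈ l)
  ... | yes few = few
  ... | no many with pigeonhole Outside (λ j → Same (R ─ ｛ k ｝) j) reps
                       (λ { (r , e , _) → cover (r , ∼⇒≢ e) (∼-sym e) })
                       (λ l → dne λ h → many (l , λ r e ¬s → dne λ n∉l → h (_ , (r , e , ¬s) , n∉l)))
    where
    Outside : VSet
    Outside n = R n × k ∼ n × ¬ Same R k n
  ...   | j , _ , inf with inf []
  ...     | n₀ , (_ , _ , ¬same) , j≈n₀ , _ = ⊥-elim (¬same same)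
    where
    same : Same R k n₀
    same F with inf (map proj₁ F ++ map proj₂ F)
    ... | n , (r , e , _) , j≈n , n∉ =
      step (k∈R , r , e , (λ i → n∉ (∈-++⁺ʳ (map proj₁ F) (∈-map⁺ proj₂ i))) , λ i → n∉ (∈-++⁺ˡ (∈-map⁺ proj₁ i)))
        (conn-⊆ proj₁ (same-sym j≈n F ◅◅ j≈n₀ F))

  many-trans : ∀ {U R m m′} → Same R m′ m → Many U R m → Many U R m′
  many-trans h many l = let n , (r , s , a) , n∉ = many l in n , (r , same-trans h s , a) , n∉

  many-clean : ∀ {U W R Z m} (σ : State U W R) → Att Z ⊆ Near U W → R° σ m → Many Z R m → Many Z (R° σ) m
  many-clean σ near m° many l with many l
  ... | n , (r , s , a) , n∉ = n , (n° , robust-same σ m° n° s , a) , n∉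
    where n° = near⇒robust _ _ r (near a)

  single-⊆ : ∀ {S : VSet} {x} → S x → In (x ∷ []) ⊆ S
  single-⊆ s (here refl) = s

  single-connected : ∀ {x} → Connected (In (x ∷ []))
  single-connected (here refl) (here refl) = here

  single-hook : ∀ {U x z} → Att U x → z ∈ x ∷ [] → ∃ λ y → y ∈ x ∷ [] × Att U y
  single-hook a (here refl) = _ , here refl , a

  ∉-single : ∀ {x y : Vertex} → x ≢ y → ¬ y ∈ x ∷ []
  ∉-single x≢y (here refl) = x≢y refl

  module Grow {U W R : VSet} (σ : State U W R) (P : List Vertex) (P⊆R : In P ⊆ R) (connP : Connected (In P))
              (hook : ∀ {x} → x ∈ P → ∃ λ y → y ∈ P × Att U y) {c : Vertex} (c∈ : (R ─ In P) c) where
    open State σ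

    U⁺ R⁻ : VSet
    U⁺ = U ∪ In P
    R⁻ = Comp (R ─ In P) [] c

    R⁻⊆R : R⁻ ⊆ R
    R⁻⊆R ((r , _) , _) = r

    R⁻-closed : ∀ {x y} → R⁻ x → (R ─ In P) y → x ∼ y → R⁻ y
    R⁻-closed x y e = Comp-step x (proj₁ x , y , e , avoids-[])

    grow : (∃ λ x → R⁻ x × Att U⁺ x) → (∃ λ x → R⁻ x × Att W x) → State U⁺ W R⁻
    grow att-U⁺ att-W = record
      { U∩W = λ { (inj₁ u) → U∩W u ; (inj₂ p) w → W∩R w (P⊆R p) }
      ; U∩R = λ { (inj₁ u) → U∩R u ∘ R⁻⊆R ; (inj₂ p) ((_ , p∉) , _) → p∉ p }
      ; W∩R = λ w → W∩R w ∘ R⁻⊆R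
      ; connU = connected-∪ connU λ p → let y , q , a = hook p in y , connP p q , q , a
      ; connW = connW ; connR = Comp-connected c∈ ; attU = att-U⁺ ; attW = att-W
      ; spread = spread-mono
          (λ { _ (inj₁ (inj₁ u)) → inj₁ (att-⊆ inj₁ u) ; _ (inj₁ (inj₂ w)) → inj₂ w
             ; _ (inj₂ p) → inj₁ (att-⊆ inj₂ p) })
          (spread-restrict spread R⁻⊆R [] P λ x r e _ ∉ → R⁻-closed x (r , ∉) e) }

    growExt : Ext U W R U⁺ W R⁻
    growExt = record
      { P = P ; Q = [] ; P⊆R = P⊆R ; Q⊆R = λ () ; connP = connP ; connQ = λ () ; hookP = hook ; hookQ = λ ()
      ; U⊆U′ = inj₁ ; P⊆U′ = inj₂ ; U′⊆ = id ; W⊆W′ = id ; Q⊆W′ = λ () ; W′⊆ = inj₁ ; R′⊆R = R⁻⊆R }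

    same⁻ : ∀ {n} → Same (R ─ In P) c n → Same R⁻ c n
    same⁻ = same-closed (λ x _ y e → R⁻-closed x y e) (c∈ , here)

    same⇒R⁻ : ∀ {n} → Same (R ─ In P) c n → R⁻ n
    same⇒R⁻ h = conn-end (c∈ , here) (same⁻ h [])

  module _ {Γ : VSet → VSet → VSet → Set (lsuc ℓ)} (closed : Closed Γ) where
    open Closed closed

    Stars : VSet → Set ℓ
    Stars R = ∀ {k} → R k → Star R k

    stars : ∀ {U W R} → State U W R → Clean U W R → Stars R ⊎ Γ U W R
    stars {U} {W} {R} σ cl with dec (Γ U W R)
    ... | yes γ = inj₂ γ
    ... | no ¬γ = inj₁ λ r → [ id , ⊥-elim ∘ ¬γ ]′ (star σ cl r)

    onClean : ∀ {U W R} (σ : State U W R) →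
      (State U W (R° σ) → Clean U W (R° σ) → Stars (R° σ) → Γ U W (R° σ)) → Γ U W R
    onClean σ h = up σ (cleanState σ) (cleanExt σ)
      ([ h (cleanState σ) (clean σ) , id ]′ (stars (cleanState σ) (clean σ)))

    bothMany : ∀ {U W R m} → State U W R → Stars R → Many U R m → Many W R m → Γ U W R
    bothMany σ st manyU manyW = core record
      { state = σ ; manyU = manyU ; manyW = manyW
      ; fewOut = λ r h → let l , q = fewOutside r (st r) in l , λ r′ e ¬s → q r′ e λ s → ¬s (same-trans h s) }

    -- By `join`, every vertex inseparable from `z` lies in one of finitely many classes of `R − z`
    -- that contain infinitely many neighbours of `z`. One of these has infinitely many vertices
    -- attached to `W`, and absorbing `z` into `U` gives it infinitely many attached to `U`.
    manyAndOne : ∀ {U W R z} → State U W R → Stars R → R z → Att U z → Many W R z → Γ U W R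
    manyAndOne {U} {W} {R} {z} σ st z∈R z~U many with st z∈R
    ... | reps , cover = finish (pigeonhole Source Joined reps
            (λ { (r , s , _ , z≢n) → let j , i , q = join (r , z≢n) s in j , i , q })
            (λ l → let n , (r , s , a) , n∉ = many (z ∷ l)
                   in n , (r , s , a , n∉ ∘ here ∘ sym) , n∉ ∘ there))
      where
      X : VSet
      X = R ─ ｛ z ｝
      Source : VSet
      Source n = R n × Same R z n × Att W n × z ≢ n
      Good : VSet
      Good j = Infinite λ n → X n × Same X j n × n ∼ z
      Joined : Vertex → VSet
      Joined j k = Good j × Same X j k
      Blocks : Vertex → Vertex → Edges → Set ℓ
      Blocks k j F = ∀ {n} → X n → n ∼ z → Same X j n → Conn X F k n → (n , z) ∈ F
      -- If k were in no good class, finitely many edges would separate k from all neighbours of z.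
      join : ∀ {k} → X k → Same R z k → ∃ λ j → j ∈ reps × Joined j k
      join {k} k∈X z≈k = dne λ none → separated none
        where
        module _ (none : ¬ ∃ λ j → j ∈ reps × Joined j k) where
          block : ∀ {j} → j ∈ reps → ∃ (Blocks k j)
          block {j} i with dec (Same X j k)
          ... | no ¬s = let F , ¬c = ¬same⇒separated ¬s in
                  F , λ _ _ j≈n c → ⊥-elim (¬c (j≈n F ◅◅ conn-sym c))
          ... | yes s = let l , ¬l = ¬∀⇒∃¬ (λ good → none (j , i , good , s)) in
                  map (_, z) l , λ n∈X e j≈n _ → ∈-map⁺ (_, z) (dne λ n∉l → ¬l (_ , (n∈X , j≈n , e) , n∉l))
          separated : ⊥
          separated with collect (Blocks k) (λ sub b n∈X e s c → sub (b n∈X e s (conn-⊑ sub c))) reps block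
          ... | F , blocked with firstHit ｛ z ｝ (proj₁ k∈X) (proj₂ k∈X) refl (same-sym z≈k F)
          ...   | n , _ , (n∈X , c) , _ , refl , e , o with cover n∈X e
          ...     | j , i , s = proj₁ o (blocked i n∈X e s c)
      finish : (∃ λ j → j ∈ reps × (∀ l → ∃ λ n → Source n × Joined j n × ¬ n ∈ l)) → Γ U W R
      finish (j , _ , inf) with inf []
      ... | n₀ , (r₀ , _ , n₀~W , z≢n₀) , (good , j≈n₀) , _ = up σ τ growExt (onClean τ λ τ° _ st° →
              bothMany τ° st° (many-clean τ inj₁ n₀° manyU′) (many-clean τ inj₂ n₀° manyW′))
        where
        n₀∈ : (R ─ In (z ∷ [])) n₀
        n₀∈ = r₀ , ∉-single z≢n₀
        open Grow σ (z ∷ []) (single-⊆ z∈R) single-connected (single-hook z~U) n₀∈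
        fromX : ∀ {n} → Same X j n → Same (R ─ In (z ∷ [])) n₀ n
        fromX s F = conn-⊆ {S = X} (λ (r , ≢) → r , ∉-single ≢) (same-sym j≈n₀ F ◅◅ s F)
        manyU′ : Many U⁺ R⁻ n₀
        manyU′ l = let n , (_ , s , e) , n∉ = good l in
          n , (same⇒R⁻ (fromX s) , same⁻ (fromX s) , z , inj₂ (here refl) , e) , n∉
        manyW′ : Many W R⁻ n₀
        manyW′ l = let n , (_ , _ , a , _) , (_ , s) , n∉ = inf l in
          n , (same⇒R⁻ (fromX s) , same⁻ (fromX s) , a) , n∉
        τ : State U⁺ W R⁻
        τ = grow (let n , (r , _ , a) , _ = manyU′ [] in n , r , a) (n₀ , (n₀∈ , here) , n₀~W)
        n₀° : R° τ n₀
        n₀° = near⇒robust _ _ (n₀∈ , here) (inj₂ n₀~W)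

    -- Unless the class of `m` already touches `U`, a path from a vertex attached to `U` is absorbed
    -- up to its first entry `z` into the class. The path lies outside the class, so the class stays
    -- inseparable, and `manyAndOne` applies at `z`.
    manyOnOneSide : ∀ {U W R m} → State U W R → Stars R → R m → Many W R m → Γ U W R
    manyOnOneSide {U} {W} {R} {m} σ st m∈R many with State.attU σ
    ... | y , y∈R , y~U with dec (Same R m y)
    ...   | yes m≈y = manyAndOne σ st y∈R y~U (many-trans (same-sym m≈y) many)
    ...   | no m≉y with firstHit (Same R m) y∈R m≉y (λ _ → here) (State.connR σ y∈R m∈R)
    ...     | w , z , ((w∈R , m≉w) , c) , z∈R , m≈z , e , _ with finiteWalk (y∈R , m≉y) c
    ...       | P , P⊆ , y∈P , w∈P , connP = up σ τ growExt (onClean τ λ τ° _ st° →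
                  manyAndOne τ° st° z° z~U⁺ (many-clean τ inj₂ z° many⁻))
      where
      z∈ : (R ─ In P) z
      z∈ = z∈R , λ i → proj₂ (P⊆ i) m≈z
      open Grow σ P (proj₁ ∘ P⊆) (connected-In connP) (λ _ → y , y∈P , y~U) z∈
      barrier : ∃ λ F → ∀ {q} → q ∈ P → ¬ Conn R F z q
      barrier = collect (λ q F → ¬ Conn R F z q) (λ sub ¬c c → ¬c (conn-⊑ sub c)) P
        λ i → ¬same⇒separated λ z≈q → proj₂ (P⊆ i) (same-trans m≈z z≈q)
      -- P lies outside the class of z, so finitely many edges keep walks in this class off P.
      off-P : ∀ {n} → Same R m n → Same (R ─ In P) z n
      off-P m≈n F = conn-⊆ {S = λ x → (R ─ In P) x × Conn R F′ z x} proj₁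
        (conn-closed
          (λ { ((q , _) , c) l@(_ , r , _) → let c′ = c ◅◅ step l here in
                 (r , λ i → proj₂ barrier i (conn-⊑ (∈-++⁺ʳ F) c′)) , c′ })
          ∈-++⁺ˡ (z∈ , here) (same-trans (same-sym m≈z) m≈n F′))
        where F′ = F ++ proj₁ barrier
      many⁻ : Many W R⁻ z
      many⁻ l = let n , (_ , s , a) , n∉ = many l in n , (same⇒R⁻ (off-P s) , same⁻ (off-P s) , a) , n∉
      z~U⁺ : Att U⁺ z
      z~U⁺ = w , inj₂ w∈P , ∼-sym e
      τ : State U⁺ W R⁻
      τ = grow (z , (z∈ , here) , z~U⁺) (let n , (r , _ , a) , _ = many⁻ [] in n , r , a)
      z° : R° τ z
      z° = near⇒robust _ _ (z∈ , here) (inj₁ z~U⁺)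

  -- Here the infinitely many neighbours belong to the first end, so `manyOnOneSide` is used with
  -- the ends exchanged.
  growTowards : ∀ {Γ} → Closed Γ → ∀ {U W R} (σ : State U W R) P (P⊆R : In P ⊆ R) (connP : Connected (In P))
    (hook : ∀ {x} → x ∈ P → ∃ λ y → y ∈ P × Att U y) {c} (c∈ : (R ─ In P) c) →
    let open Grow σ P P⊆R connP hook c∈ in
    (∃ λ x → R⁻ x × Att W x) → Att U⁺ c → Many U⁺ R⁻ c → Γ U W R
  growTowards closed σ P P⊆R connP hook {c} c∈ att-W c~U⁺ many = Closed.up closed σ τ growExt
      (onClean closed τ λ τ° _ st° → manyOnOneSide (closed-swap closed) (swapState τ°) st° c° (many-clean τ inj₁ c° many))
    where
    open Grow σ P P⊆R connP hook c∈
    τ = grow (c , (c∈ , here) , c~U⁺) att-W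
    c° : R° τ c
    c° = near⇒robust _ _ (c∈ , here) (inj₁ c~U⁺)

  module _ {Γ : VSet → VSet → VSet → Set (lsuc ℓ)} (closed : Closed Γ) where
    open Closed closed

    -- Infinitely many neighbours of `p` lie in one class of `R − p`, inside a component `A`. The
    -- end that absorbs `p` gets these neighbours, and `A` has to touch the other end. If `A`
    -- touches `U`, then `p` joins `W`; otherwise `A` touches `W` by cleanness, and `p` joins `U`
    -- along a path avoiding `A`.
    fromClean : ∀ {U W R} → State U W R → Clean U W R → Stars closed R → Γ U W R
    fromClean {U} {W} {R} σ cl st with State.attW σ
    ... | p , p∈R , p~W with st p∈R
    ...   | reps , cover with pigeonhole (λ n → R n × p ∼ n) (Same (R ─ ｛ p ｝)) reps
                              (λ (r , e) → cover (r , ∼⇒≢ e) (∼-sym e)) (infinite-degree (State.spread σ) p∈R)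
    ...     | j , _ , inf with inf []
    ...       | c , (r , p∼c) , j≈c , _ = choose (dec (∃ λ x → A x × Att U x))
      where
      X A : VSet
      X = R ─ ｛ p ｝
      A = Comp X [] c
      c∈X : X c
      c∈X = r , ∼⇒≢ p∼c
      A-closed : ∀ {x y} → A x → X y → x ∼ y → A y
      A-closed a x e = Comp-step a (proj₁ a , x , e , avoids-[])
      sameA : ∀ {n} → Same X j n → Same A c n
      sameA s = same-closed (λ a _ x e → A-closed a x e) (c∈X , here) (same-trans (same-sym j≈c) s)
      many⁺ : ∀ {Z R⁻ : VSet} → Z p → (∀ {n} → Same A c n → Same R⁻ c n × R⁻ n) → Many Z R⁻ c
      many⁺ z inherit l = let n , (_ , e) , s , n∉ = inf l ; s′ , r′ = inherit (sameA s) in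
        n , (r′ , s′ , p , z , ∼-sym e) , n∉
      choose : Dec (∃ λ x → A x × Att U x) → Γ U W R
      choose (yes (x , (_ , w) , x~U)) =
        growTowards (closed-swap closed) (swapState σ) (p ∷ []) (single-⊆ p∈R) single-connected (single-hook p~W) c∈
          (x , (conn-end c∈ (conn-⊆ X⊆ w) , conn-⊆ X⊆ w) , x~U)
          (p , inj₂ (here refl) , ∼-sym p∼c)
          (many⁺ (inj₂ (here refl)) λ s → same⁻ (into s) , same⇒R⁻ (into s))
        where
        X⊆ : X ⊆ R ─ In (p ∷ [])
        X⊆ (r , ≢) = r , ∉-single ≢
        c∈ : (R ─ In (p ∷ [])) c
        c∈ = X⊆ c∈X
        open Grow (swapState σ) (p ∷ []) (single-⊆ p∈R) single-connected (single-hook p~W) c∈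
        into : ∀ {n} → Same A c n → Same (R ─ In (p ∷ [])) c n
        into s F = conn-⊆ (X⊆ ∘ proj₁) (s F)
      choose (no A≁U) with bypass σ p∈R A-closed (λ a u → A≁U (_ , a , u))
      ... | y , (_ , w) , y~U with finiteWalk (p∈R , λ a → proj₂ (proj₁ a) refl) w
      ...   | P , P⊆ , p∈P , y∈P , connP = growTowards closed σ P (proj₁ ∘ P⊆) (connected-In connP) (λ _ → y , y∈P , y~U) c∈
                attached-W (p , inj₂ p∈P , ∼-sym p∼c) (many⁺ (inj₂ p∈P) λ s → same⁻ (into s) , same⇒R⁻ (into s))
        where
        A⊆ : A ⊆ R ─ In P
        A⊆ a = proj₁ (proj₁ a) , λ i → proj₂ (P⊆ i) a
        c∈ : (R ─ In P) c
        c∈ = A⊆ (c∈X , here)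
        open Grow σ P (proj₁ ∘ P⊆) (connected-In connP) (λ _ → y , y∈P , y~U) c∈
        into : ∀ {n} → Same A c n → Same (R ─ In P) c n
        into s F = conn-⊆ A⊆ (s F)
        attached-W : ∃ λ x → R⁻ x × Att W x
        attached-W with cl r (∼⇒≢ p∼c)
        ... | x , a , inj₁ x~U = ⊥-elim (A≁U (x , a , x~U))
        ... | x , a@(_ , w′) , inj₂ x~W = x , (A⊆ a , conn-⊆ A⊆ (Comp-connected c∈X (c∈X , here) a)) , x~W

  outcome : ∀ {U W R} → State U W R → Outcome U W R
  outcome σ = onClean closed-Outcome σ (fromClean closed-Outcome)

-- The football obtained by contraction onto a class

module FootballMinor (lem : ∀ {a} → ExcludedMiddle a) {ℓ : Level} (G : Graph ℓ) where
  open Classical lem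
  open Connectivity lem G
  open Outcomes lem G

  -- The first hit in a list depends only on which vertices satisfy `Q`. A witness taken from a
  -- proof of existence could differ between adjacent vertices of one component, and branch sets
  -- would be disconnected. This is why a countable, enumerated part of `R` is used.
  data FirstIn (Q : VSet) : List Vertex → Vertex → Set ℓ where
    now : ∀ {x xs} → Q x → FirstIn Q (x ∷ xs) x
    later : ∀ {x xs k} → ¬ Q x → FirstIn Q xs k → FirstIn Q (x ∷ xs) k

  firstIn-sat : ∀ {Q l k} → FirstIn Q l k → Q k
  firstIn-sat (now q) = q
  firstIn-sat (later _ f) = firstIn-sat f

  firstIn-exists : ∀ {Q l x} → x ∈ l → Q x → ∃ (FirstIn Q l)
  firstIn-exists {Q} {y ∷ _} i q with dec (Q y)
  ... | yes q′ = y , now q′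
  firstIn-exists (here refl) q | no ¬q = ⊥-elim (¬q q)
  firstIn-exists (there i) q | no ¬q = let k , f = firstIn-exists i q in k , later ¬q f

  firstIn-unique : ∀ {Q l k k′} → FirstIn Q l k → FirstIn Q l k′ → k ≡ k′
  firstIn-unique (now _) (now _) = refl
  firstIn-unique (now q) (later ¬q _) = ⊥-elim (¬q q)
  firstIn-unique (later ¬q _) (now q) = ⊥-elim (¬q q)
  firstIn-unique (later _ f) (later _ f′) = firstIn-unique f f′

  firstIn-++ : ∀ {Q l k} l′ → FirstIn Q l k → FirstIn Q (l ++ l′) k
  firstIn-++ l′ (now q) = now q
  firstIn-++ l′ (later ¬q f) = later ¬q (firstIn-++ l′ f)

  firstIn-cong : ∀ {Q Q′ l k} → Q ⊆ Q′ → Q′ ⊆ Q → FirstIn Q l k → FirstIn Q′ l k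
  firstIn-cong to from (now q) = now (to q)
  firstIn-cong to from (later ¬q f) = later (¬q ∘ from) (firstIn-cong to from f)

  module _ {U W R : VSet} {m : Vertex} (c : Core U W R m) where
    open Core c
    open State state

    private
      K : VSet
      K x = R x × Same R m x

      -- Deleting all pairs from `l` lets one walk serve for every finite set `F` whose ends in `R₀`
      -- lie in `l`.
      visits : List Vertex → Vertex → Vertex → List Vertex
      visits l x y with dec (K x × K y)
      ... | no _ = []
      ... | yes ((x∈R , m≈x) , (_ , m≈y)) =
        proj₁ (finiteWalk x∈R (same-trans (same-sym m≈x) m≈y (cartesianProduct l l)))

      visits-spec : ∀ l {x y} → K x → K y →
        In (visits l x y) ⊆ R × Conn (In (visits l x y)) (cartesianProduct l l) x y
      visits-spec l {x} {y} kx ky with dec (K x × K y)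
      ... | no ¬k = ⊥-elim (¬k (kx , ky))
      ... | yes ((x∈R , m≈x) , (_ , m≈y))
          with finiteWalk x∈R (same-trans (same-sym m≈x) m≈y (cartesianProduct l l))
      ...   | _ , sub , _ , y∈ , conn = sub , conn y∈

      -- The two leading vertices provide both ends with infinitely many neighbours in the countable
      -- part; the walks keep its vertices of `K` inseparable.
      extend : List Vertex → List Vertex
      extend l = (proj₁ (manyU l) ∷ proj₁ (manyW l) ∷ [])
        ++ concatMap (λ x → concatMap (visits l x) l) l

      -- Each stage is a prefix of the next, so the first element with a given property does not
      -- change once it exists.
      stage : ℕ → List Vertex
      stage zero = []
      stage (suc n) = stage n ++ extend (stage n)

      stage-mono : ∀ d {n} → In (stage n) ⊆ In (stage (d + n))
      stage-mono zero i = i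
      stage-mono (suc d) i = ∈-++⁺ˡ (stage-mono d i)

      -- A countable part of R in which the vertices of K are still inseparable.
      R₀ : VSet
      R₀ x = R x × ∃ λ n → x ∈ stage n

      K₀ : VSet
      K₀ x = K x × R₀ x

      stage-≤ : ∀ {n n′} → n ≤ n′ → In (stage n) ⊆ In (stage n′)
      stage-≤ {n} le {x} i with m≤n⇒∃[o]m+o≡n le
      ... | d , refl = subst (λ k → x ∈ stage k) (+-comm d n) (stage-mono d i)

      covering : ∀ l → ∃ λ N → ∀ {x} → x ∈ l → R₀ x → x ∈ stage N
      covering [] = 0 , λ ()
      covering (x ∷ l) with covering l | dec (R₀ x)
      ... | N , h | no ¬r = N , λ { (here refl) r → ⊥-elim (¬r r) ; (there i) r → h i r }
      ... | N , h | yes (_ , n , i₀) = N ⊔ℕ n , λ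
        { (here refl) _ → stage-≤ (m≤n⊔m N n) i₀ ; (there i) r → stage-≤ (m≤m⊔n N n) (h i r) }

      -- Some stage contains `x`, `y` and all ends of `F` that lie in `R₀`. The walk added for this
      -- pair at the next stage uses no edge between vertices of that stage, hence none of `F`.
      inseparable : ∀ {x y} → K₀ x → K₀ y → ∀ F → Conn R₀ F x y
      inseparable {x} {y} (kx , rx) (ky , ry) F = gmap id relax (proj₂ (visits-spec l kx ky))
        where
        ends = x ∷ y ∷ map proj₁ F ++ map proj₂ F
        N = proj₁ (covering ends)
        l = stage N
        in-l : ∀ {z} → z ∈ ends → R₀ z → z ∈ l
        in-l = proj₂ (covering ends)
        next : ∀ {z} → z ∈ visits l x y → R₀ z
        next i = proj₁ (visits-spec l kx ky) i , suc N , ∈-++⁺ʳ l (there (there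
          (∈-concatMap⁺ _ (lose (in-l (here refl) rx) (∈-concatMap⁺ (visits l x) (lose (in-l (there (here refl)) ry) i))))))
        old : ∀ {a b} → (a , b) ∈ F → R₀ a → R₀ b → (a , b) ∈ cartesianProduct l l
        old i ra rb = ∈-cartesianProduct⁺ (in-l (there (there (∈-++⁺ˡ (∈-map⁺ proj₁ i)))) ra)
          (in-l (there (there (∈-++⁺ʳ (map proj₁ F) (∈-map⁺ proj₂ i)))) rb)
        relax : ∀ {a b} → Link (In (visits l x y)) (cartesianProduct l l) a b → Link R₀ F a b
        relax (a , b , e , o) = next a , next b , e
          , (λ i → proj₁ o (old i (next a) (next b))) , λ i → proj₂ o (old i (next b) (next a))

      many₀ : ∀ {Z} → (many : Many Z R m) → (∀ l → proj₁ (many l) ∈ extend l) →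
        ∀ l → ∃ λ n → K₀ n × Att Z n × ¬ n ∈ l
      many₀ many added l with covering l
      ... | N , h with many (stage N) | added (stage N)
      ...   | n , (r , s , a) , n∉ | i = n , ((r , s) , r₀) , a , λ j → n∉ (h j r₀)
        where
        r₀ : R₀ n
        r₀ = r , suc N , ∈-++⁺ʳ (stage N) i

      -- The vertices of K to which x may be contracted.
      Target : Vertex → VSet
      Target x k = K₀ k × (x ≡ k ⊎ (¬ K x × ∃ λ z → Comp (R₀ ─ K) [] x z × z ∼ k))

      -- Taking the first target in the enumeration makes the choice constant on components of R₀ − K.
      Rep : Vertex → VSet
      Rep x k = ∃ λ n → FirstIn (Target x) (stage n) k

      rep-target : ∀ {x k} → Rep x k → Target x k
      rep-target (_ , f) = firstIn-sat f

      rep-exists : ∀ {x k} → Target x k → ∃ (Rep x)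
      rep-exists t@((_ , _ , n , i) , _) = let k , f = firstIn-exists i t in k , n , f

      rep-mono : ∀ {x k n} d → FirstIn (Target x) (stage n) k → FirstIn (Target x) (stage (d + n)) k
      rep-mono zero f = f
      rep-mono (suc d) f = firstIn-++ _ (rep-mono d f)

      rep-unique : ∀ {x k k′} → Rep x k → Rep x k′ → k ≡ k′
      rep-unique {x} {k} (n , f) (n′ , f′) = firstIn-unique
        (subst (λ j → FirstIn (Target x) (stage j) k) (+-comm n′ n) (rep-mono n′ f)) (rep-mono n f′)

      target-step : ∀ {x y} → (R₀ ─ K) x → (R₀ ─ K) y → x ∼ y → Target x ⊆ Target y
      target-step (_ , ¬kx) _ _ (k₀@(kk , _) , inj₁ refl) = ⊥-elim (¬kx kk)
      target-step x y e (k₀ , inj₂ (_ , z , (rz , w) , e′)) =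
        k₀ , inj₂ (proj₂ y , z , (rz , step (y , x , ∼-sym e , avoids-[]) w) , e′)

      rep-step : ∀ {x y k} → (R₀ ─ K) x → (R₀ ─ K) y → x ∼ y → Rep x k → Rep y k
      rep-step x y e (n , f) = n , firstIn-cong (target-step x y e) (target-step y x (∼-sym e)) f

      rep-self : ∀ {k} → K₀ k → Rep k k
      rep-self k₀@(kk , _) with rep-exists (k₀ , inj₁ refl)
      ... | k′ , r with rep-target r
      ...   | _ , inj₁ refl = r
      ...   | _ , inj₂ (¬k , _) = ⊥-elim (¬k kk)

      rep-K : ∀ {x k} → K x → Rep x k → x ≡ k
      rep-K kx r with rep-target r
      ... | _ , inj₁ eq = eq
      ... | _ , inj₂ (¬k , _) = ⊥-elim (¬k kx)

      -- The membership proof is irrelevant so that a vertex gives only one node, as disjointness of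
      -- branch sets requires. Where the proof is needed, `recompute` recovers it.
      data Node : Set ℓ where
        left right : Node
        mid : (k : Vertex) → .(K₀ k) → Node

      mid-cong : ∀ {k k′} .{p : K₀ k} .{q : K₀ k′} → k ≡ k′ → mid k p ≡ mid k′ q
      mid-cong refl = refl

      Branch : Node → VSet
      Branch left = U
      Branch right = W
      Branch (mid k _) x = R₀ x × Rep x k

      branch-disjoint : ∀ h h′ x → Branch h x → Branch h′ x → h ≡ h′
      branch-disjoint left left x _ _ = refl
      branch-disjoint left right x u w = ⊥-elim (U∩W u w)
      branch-disjoint left (mid _ _) x u ((r , _) , _) = ⊥-elim (U∩R u r)
      branch-disjoint right left x w u = ⊥-elim (U∩W u w)
      branch-disjoint right right x _ _ = refl
      branch-disjoint right (mid _ _) x w ((r , _) , _) = ⊥-elim (W∩R w r)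
      branch-disjoint (mid _ _) left x ((r , _) , _) u = ⊥-elim (U∩R u r)
      branch-disjoint (mid _ _) right x ((r , _) , _) w = ⊥-elim (W∩R w r)
      branch-disjoint (mid _ _) (mid _ _) x (_ , r) (_ , r′) = mid-cong (rep-unique r r′)

      to-rep : ∀ {x k} .{k₀ : K₀ k} → Branch (mid k k₀) x → Conn (Branch (mid k k₀)) [] x k
      to-rep {x} {k} (rx , r) with rep-target r
      ... | _ , inj₁ refl = here
      ... | k₀ , inj₂ (¬kx , z , (rz , w) , e) =
        conn-⊆ proj₁ w′ ◅◅ step (proj₁ (conn-end (((rx , r) , ¬kx)) w′) , (proj₂ k₀ , rep-self k₀) , e , avoids-[]) here
        where
        w′ : Conn (λ y → (R₀ y × Rep y k) × ¬ K y) [] x z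
        w′ = conn-closed (λ { ((ra , rep) , ¬ka) (a , b , e , _) → (proj₁ b , rep-step a b e rep) , proj₂ b }) id
          ((rx , r) , ¬kx) w

      branch-connected : ∀ h → Connected (Branch h)
      branch-connected left = connU
      branch-connected right = connW
      branch-connected (mid k k₀) x y = to-rep {k₀ = k₀} x ◅◅ conn-sym (to-rep {k₀ = k₀} y)

      branch-nonempty : ∀ h → ∃ (Branch h)
      branch-nonempty left = let _ , _ , u , uu , _ = attU in u , uu
      branch-nonempty right = let _ , _ , w , ww , _ = attW in w , ww
      branch-nonempty (mid k k₀) = k , proj₂ (recompute (dec (K₀ k)) k₀) , rep-self (recompute (dec (K₀ k)) k₀)

    contraction : Graph ℓ
    contraction = record
      { V = Node
      ; _~_ = λ h h′ → h ≢ h′ × ∃ λ x → ∃ λ y → Branch h x × Branch h′ y × x ∼ y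
      ; ~-sym = λ { (≢ , x , y , bx , by , e) → ≢ ∘ sym , y , x , by , bx , ∼-sym e }
      ; ~-irr = λ { (≢ , _) → ≢ refl } }

    private
      H = contraction
      NodeEdges : Set ℓ
      NodeEdges = List (Node × Node)

      Middle : Node → Set ℓ
      Middle h = h ≢ left × h ≢ right

      outgoing : Node → Edges
      outgoing left = []
      outgoing right = []
      outgoing (mid k k₀) = let (r , s) , _ = recompute (dec (K₀ k)) k₀ in map (k ,_) (proj₁ (fewOut r s))

      direct : Node → Node → Edges
      direct (mid k _) (mid k′ _) = (k , k′) ∷ []
      direct _ _ = []

      -- Finitely many edges of G are behind each edge of the contraction.
      preimage : NodeEdges → Edges
      preimage = concatMap λ (h , h′) → direct h h′ ++ outgoing h ++ outgoing h′

      preimage⁺ : ∀ {F h h′ e} → (h , h′) ∈ F → e ∈ direct h h′ ++ outgoing h ++ outgoing h′ → e ∈ preimage F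
      preimage⁺ i j = ∈-concatMap⁺ _ (lose i j)

      outgoing⁺ : ∀ {k n} .(k₀ : K₀ k) → R n → k ∼ n → ¬ K n → (k , n) ∈ outgoing (mid k k₀)
      outgoing⁺ {k} k₀ r e ¬k = let (rk , s) , _ = recompute (dec (K₀ k)) k₀ in
        ∈-map⁺ (k ,_) (proj₂ (fewOut rk s) r e λ same → ¬k (r , same))

      HLink : NodeEdges → Node → Node → Set ℓ
      HLink F = StepAvoiding H Middle F

      hop : ∀ {F c c′ h h′} .{h₀ : K₀ h} .{h₀′ : K₀ h′} →
        Branch (mid h h₀) c → Branch (mid h′ h₀′) c′ → c ∼ c′ →
        ¬ (mid h h₀ , mid h′ h₀′) ∈ F → ¬ (mid h′ h₀′ , mid h h₀) ∈ F →
        Walk (HLink F) (mid h h₀) (mid h′ h₀′)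
      hop {h = h} {h′} b b′ e i j with dec (h ≡ h′)
      -- An edge within one branch set needs no step in the contraction.
      ... | yes refl = here
      ... | no h≢h′ = step (((λ { refl → h≢h′ refl }) , _ , _ , b , b′ , e) , ((λ ()) , (λ ())) , i , j) here

      -- A step between two vertices outside `K` stays in one component of `R₀ − K`, hence in one
      -- branch set. Any other step joins two vertices of `K` or is one of the finitely many edges
      -- by which a vertex of `K` leaves `K`; `preimage F` contains all such edges behind `F`.
      translate : ∀ {F c y h} .{h₀ : K₀ h} (y₀ : K₀ y) → Branch (mid h h₀) c → Conn R₀ (preimage F) c y →
        Walk (HLink F) (mid h h₀) (mid y y₀)
      translate {h₀ = h₀} y₀ (_ , r) here with rep-K (proj₁ y₀) r
      ... | refl = here
      translate {F} {c} {h = h} {h₀} y₀ b@(rc , r) (step {y = c′} (_ , rc′ , e , o) w)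
        with dec (K c) | dec (K c′)
      ... | no ¬k | no ¬k′ = translate y₀ (rc′ , rep-step (rc , ¬k) (rc′ , ¬k′) e r) w
      ... | yes k | yes k′ with rep-K k r
      ...   | refl = hop {h₀′ = k′ , rc′} b b′ e (λ i → proj₁ o (preimage⁺ i (here refl)))
                (λ i → proj₂ o (preimage⁺ i (here refl))) ◅◅ translate y₀ b′ w
        where
        b′ : Branch (mid c′ (k′ , rc′)) c′
        b′ = rc′ , rep-self (k′ , rc′)
      translate {F} {c} {h = h} {h₀} y₀ b@(rc , r) (step {y = c′} (_ , rc′ , e , o) w)
          | yes k | no ¬k′ with rep-K k r | rep-exists ((k , rc) , inj₂ (¬k′ , c′ , ((rc′ , ¬k′) , here) , ∼-sym e))
      ...   | refl | h′ , r′ = hop {h₀′ = proj₁ (rep-target r′)} b (rc′ , r′) e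
                (λ i → proj₁ o (preimage⁺ i (there (∈-++⁺ˡ out))))
                (λ i → proj₁ o (preimage⁺ i (there (∈-++⁺ʳ (outgoing (mid h′ (proj₁ (rep-target r′)))) out))))
              ◅◅ translate y₀ (rc′ , r′) w
        where
        out : (c , c′) ∈ outgoing (mid c (k , rc))
        out = outgoing⁺ (k , rc) (proj₁ rc′) e ¬k′
      translate {F} {c} {h = h} {h₀} y₀ b@(rc , r) (step {y = c′} (_ , rc′ , e , o) w)
          | no ¬k | yes k′ = hop {h₀′ = k′ , rc′} b b′ e
                (λ i → proj₂ o (preimage⁺ i (there (∈-++⁺ʳ (outgoing (mid h h₀)) out))))
                (λ i → proj₂ o (preimage⁺ i (there (∈-++⁺ˡ out)))) ◅◅ translate y₀ b′ w
        where
        b′ : Branch (mid c′ (k′ , rc′)) c′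
        b′ = rc′ , rep-self (k′ , rc′)
        out : (c′ , c) ∈ outgoing (mid c′ (k′ , rc′))
        out = outgoing⁺ (k′ , rc′) (proj₁ rc) (∼-sym e) ¬k

      middle-connected : ∀ {k k′} .{k₀ : K₀ k} .{k₀′ : K₀ k′} F → Walk (HLink F) (mid k k₀) (mid k′ k₀′)
      middle-connected {k} {k′} {k₀} {k₀′} F = translate k′₁ (proj₂ k₁ , rep-self k₁) (inseparable k₁ k′₁ (preimage F))
        where
        k₁ = recompute (dec (K₀ k)) k₀
        k′₁ = recompute (dec (K₀ k′)) k₀′

      nodeNames : NodeEdges → List Vertex
      nodeNames = concatMap λ (h , h′) → name h ++ name h′
        where
        name : Node → List Vertex
        name (mid k _) = k ∷ []
        name _ = []

      HStep : NodeEdges → Node → Node → Set ℓ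
      HStep = StepAvoiding H (λ _ → ⊤)

      -- Each end has infinitely many neighbours in `K₀`, and `F` names only finitely many of them.
      toMiddle : ∀ F h → ∃ λ k → Σ (K₀ k) λ k₀ → Walk (HStep F) h (mid k k₀)
      toMiddle F (mid k k₀) = k , recompute (dec (K₀ k)) k₀ , here
      toMiddle F left with many₀ manyU (λ _ → here refl) (nodeNames F)
      ... | k , k₀ , (u , uu , e) , k∉ = k , k₀ , step
            (((λ ()) , u , k , uu , (proj₂ k₀ , rep-self k₀) , ∼-sym e) , _
            , (λ i → k∉ (∈-concatMap⁺ _ (lose i (here refl)))) , λ i → k∉ (∈-concatMap⁺ _ (lose i (here refl)))) here
      toMiddle F right with many₀ manyW (λ _ → there (here refl)) (nodeNames F)
      ... | k , k₀ , (u , uu , e) , k∉ = k , k₀ , step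
            (((λ ()) , u , k , uu , (proj₂ k₀ , rep-self k₀) , ∼-sym e) , _
            , (λ i → k∉ (∈-concatMap⁺ _ (lose i (here refl)))) , λ i → k∉ (∈-concatMap⁺ _ (lose i (here refl)))) here

      hstep-sym : ∀ {F h h′} → HStep F h h′ → HStep F h′ h
      hstep-sym (e , _ , i , j) = ~-sym H e , _ , j , i

      infEdgeConnected : InfEdgeConnected H
      infEdgeConnected h h′ _ _ F with toMiddle F h | toMiddle F h′
      ... | k , k₀ , w | k′ , k₀′ , w′ = w
        ◅◅ gmap id (λ (e , _ , i , j) → e , _ , i , j) (middle-connected {k₀ = k₀} {k₀′} F)
        ◅◅ reverse hstep-sym w′

      middle-infEdgeConnected : InfEdgeConnectedOn H Middle
      middle-infEdgeConnected left _ (≢ , _) _ _ = ⊥-elim (≢ refl)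
      middle-infEdgeConnected right _ (_ , ≢) _ _ = ⊥-elim (≢ refl)
      middle-infEdgeConnected (mid _ _) left _ (≢ , _) _ = ⊥-elim (≢ refl)
      middle-infEdgeConnected (mid _ _) right _ (_ , ≢) _ = ⊥-elim (≢ refl)
      middle-infEdgeConnected (mid _ _) (mid _ _) _ _ F = middle-connected F

    core⇒football : ∀ {S} → U ⊆ S → W ⊆ S → R ⊆ S →
      Σ (Graph ℓ) λ H → ∃ λ u′ → ∃ λ v′ → Football H u′ v′ ×
        Σ (MinorModel G S H) λ M → U ⊆ MinorModel.B M u′ × W ⊆ MinorModel.B M v′
    core⇒football U⊆S W⊆S R⊆S = H , left , right , ((λ ()) , infEdgeConnected , middle-infEdgeConnected)
      , record
        { B = Branch
        ; B⊆S = λ { left _ → U⊆S ; right _ → W⊆S ; (mid _ _) _ ((r , _) , _) → R⊆S r }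
        ; disjoint = branch-disjoint ; nonempty = branch-nonempty
        ; connected = λ h _ _ x y → gmap id (λ (_ , b , e , _) → e , b) (branch-connected h x y)
        ; edges = λ { _ _ (_ , q) → q } }
      , id , id

-- Tree minors from iterated branching

module TreeMinors (lem : ∀ {a} → ExcludedMiddle a) {ℓ : Level} (G : Graph ℓ) where
  open Classical lem
  open Connectivity lem G
  open Branching lem G
  open Outcomes lem G
  open FootballSearch lem G

  treeMinor : ∀ {S : VSet} (t : VSet) (B : List ℕ → VSet) →
    t ⊆ S → (∀ s → B s ⊆ S) → Connected t → (∀ s → Connected (B s)) →
    (∀ {s s′ x} → B s x → B s′ x → s ≡ s′) → (∀ {s x} → t x → ¬ B s x) →
    (∀ s → ∃ λ x → B s x × Att t x) → (∀ n s → ∃ λ x → B (n ∷ s) x × Att (B s) x) →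
    MinorModel G S TℵStar
  treeMinor {S} t B t⊆S B⊆S conn-t conn-B disjoint-B t∩B t~B B~B = record
    { B = branch
    ; B⊆S = λ { nothing _ → t⊆S ; (just s) _ → B⊆S s }
    ; disjoint = λ { nothing nothing _ _ _ → refl ; nothing (just _) _ x b → ⊥-elim (t∩B x b)
                   ; (just _) nothing _ b x → ⊥-elim (t∩B x b) ; (just _) (just _) _ b b′ → cong just (disjoint-B b b′) }
    ; nonempty = λ { nothing → let _ , _ , y , ty , _ = t~B [] in y , ty ; (just s) → let x , b , _ = t~B s in x , b }
    ; connected = λ { nothing _ _ x y → induced (conn-t x y) ; (just s) _ _ x y → induced (conn-B s x y) }
    ; edges = λ { nothing (just s) _ → let x , b , y , ty , e = t~B s in y , x , ty , b , ∼-sym e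
                ; (just s) nothing _ → let x , b , y , ty , e = t~B s in x , y , b , ty , e
                ; (just s) (just s′) (inj₁ (child n _)) → let x , b , y , b′ , e = B~B n s in y , x , b′ , b , ∼-sym e
                ; (just s) (just s′) (inj₂ (child n _)) → let x , b , y , b′ , e = B~B n s′ in x , y , b , b′ , e } }
    where
    branch : Maybe (List ℕ) → VSet
    branch nothing = t
    branch (just s) = B s
    induced : ∀ {T x y} → Conn T [] x y → Walk (StepIn G T) x y
    induced = gmap id λ (_ , b , e , _) → e , b

  module _ (R B : List ℕ → VSet) (B⊆R : ∀ {s} → B s ⊆ R s) (nested : ∀ {n s} → R (n ∷ s) ⊆ R s)
           (siblings : ∀ {n n′ s x} → R (n ∷ s) x → R (n′ ∷ s) x → n ≡ n′)
           (apart : ∀ {n s x} → B s x → ¬ R (n ∷ s) x) where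

    private
      level-disjoint : ∀ s s′ {x} → length s ≡ length s′ → R s x → R s′ x → s ≡ s′
      level-disjoint [] [] _ _ _ = refl
      level-disjoint (n ∷ s) (n′ ∷ s′) eq r r′ with level-disjoint s s′ (suc-injective eq) (nested r) (nested r′)
      ... | refl = cong (_∷ s) (siblings r r′)

      no-descendant : ∀ {s x} → B s x → ∀ s′ → length s ≤ length s′ → R s′ x → s ≡ s′
      no-descendant {[]} b [] _ _ = refl
      no-descendant {s} b (n ∷ s′) le r with m≤n⇒m<n∨m≡n le
      ... | inj₂ eq = level-disjoint s (n ∷ s′) eq (B⊆R b) r
      ... | inj₁ (s≤s le′) with no-descendant b s′ le′ (nested r)
      ...   | refl = ⊥-elim (apart b r)

    -- Regions of sequences of equal length are disjoint for different sequences, and `B s` avoids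
    -- the regions of all proper extensions of `s`.
    nested-disjoint : ∀ {s s′ x} → B s x → B s′ x → s ≡ s′
    nested-disjoint {s} {s′} b b′ with ≤-total (length s) (length s′)
    ... | inj₁ le = no-descendant b s′ le (B⊆R b′)
    ... | inj₂ le = sym (no-descendant b′ s le (B⊆R b))

  module _ {U W R : VSet} (σ : State U W R)
           (keep : ∀ {U′ R′} → State U′ W R′ → U ⊆ U′ → U′ ⊆ U ∪ R → R′ ⊆ R → Keep U′ W R′) where

    private
      -- The branch set `bag` consists of two finite walks from `entry`, which touches the parent:
      -- one to `p`, for the children, and one to a neighbour of `W`, for the vertex `t`.
      record Node : Set (lsuc ℓ) where
        field
          {U′ R′} : VSet
          state : State U′ W R′
          U⊆U′ : U ⊆ U′
          U′⊆ : U′ ⊆ U ∪ R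
          R′⊆R : R′ ⊆ R
          {entry} : Vertex
          entry∈ : R′ entry
        open State state public
        module K = Keep (keep state U⊆U′ U′⊆ R′⊆R)
        toHub = finiteWalk entry∈ (connR entry∈ K.p∈R)
        toEnd = finiteWalk entry∈ (connR entry∈ (proj₁ (proj₂ attW)))
        bag : List Vertex
        bag = proj₁ toHub ++ proj₁ toEnd
        bag⊆ : In bag ⊆ R′
        bag⊆ i = [ proj₁ (proj₂ toHub) , proj₁ (proj₂ toEnd) ]′ (∈-++⁻ (proj₁ toHub) i)
        entry∈bag : entry ∈ bag
        entry∈bag = ∈-++⁺ˡ (proj₁ (proj₂ (proj₂ toHub)))
        p∈bag : K.p ∈ bag
        p∈bag = ∈-++⁺ˡ (proj₁ (proj₂ (proj₂ (proj₂ toHub))))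
        bag-att : ∃ λ x → x ∈ bag × Att W x
        bag-att = proj₁ attW , ∈-++⁺ʳ (proj₁ toHub) (proj₁ (proj₂ (proj₂ (proj₂ toEnd)))) , proj₂ (proj₂ attW)
        bag-connected : Connected (In bag)
        bag-connected = connected-In λ i →
          [ conn-⊆ ∈-++⁺ˡ ∘ proj₂ (proj₂ (proj₂ (proj₂ toHub)))
          , conn-⊆ (∈-++⁺ʳ (proj₁ toHub)) ∘ proj₂ (proj₂ (proj₂ (proj₂ toEnd))) ]′ (∈-++⁻ (proj₁ toHub) i)
        late = avoidsEventually {K.Rs} K.disjoint bag
        N = proj₁ late
      open Node

      descend : Node → ℕ → Node
      descend v n = record
        -- The shift by `N v` skips the regions that meet the finite bag of the parent.
        { state = K.states v (N v + n) ; U⊆U′ = K.U⊆U′ v ∘ U⊆U′ v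
        ; U′⊆ = λ x → [ U′⊆ v , inj₂ ∘ R′⊆R v ]′ (K.U′⊆ v x) ; R′⊆R = R′⊆R v ∘ K.Rs⊆R v
        ; entry∈ = proj₁ (proj₂ (K.touch v (N v + n))) }

      node : List ℕ → Node
      node [] = record { state = σ ; U⊆U′ = id ; U′⊆ = inj₁ ; R′⊆R = id ; entry∈ = proj₁ (proj₂ (State.attU σ)) }
      node (n ∷ s) = descend (node s) n

    keepTree : ∀ {S : VSet} → W ⊆ S → R ⊆ S → MinorModel G S TℵStar
    keepTree W⊆S R⊆S = treeMinor W (λ s → In (bag (node s))) W⊆S (λ s i → R⊆S (R′⊆R (node s) (bag⊆ (node s) i)))
      (State.connW σ) (λ s → bag-connected (node s))
      (nested-disjoint (λ s → R′ (node s)) (λ s → In (bag (node s))) (λ {s} → bag⊆ (node s))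
        (λ {n} {s} → K.Rs⊆R (node s))
        (λ {n} {n′} {s} r r′ → +-cancelˡ-≡ (N (node s)) n n′ (K.disjoint (node s) r r′))
        (λ {n} {s} i → proj₂ (late (node s)) n i))
      (λ {s} w i → W∩R (node s) w (bag⊆ (node s) i))
      (λ s → bag-att (node s))
      (λ n s → entry (node (n ∷ s)) , entry∈bag (node (n ∷ s)) , K.p (node s) , p∈bag (node s)
             , proj₂ (proj₂ (K.touch (node s) (N (node s) + n))))

  -- Since `P` is attached to `W`, adding `W` to the second end of a football found after a move
  -- gives a football for the state before it.
  foot-shift : ∀ {U W R U′ P R′} → State U W R → U ⊆ U′ → U′ ⊆ U ∪ R → P ⊆ R → (∃ λ x → P x × Att W x) →
    R′ ⊆ R → Foot U′ P R′ → Foot U W R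
  foot-shift {U} {W} {R} σ U⊆ U′⊆ P⊆R (x , px , x~W) R′⊆R f = record
    { core = record
        { state = record
            { U∩W = λ { u (inj₁ w) → [ (λ u′ → σ.U∩W u′ w) , σ.W∩R w ]′ (X⊆ u) ; u (inj₂ y) → τ.U∩W u y }
            ; U∩R = τ.U∩R
            ; W∩R = λ { (inj₁ w) r → σ.W∩R w (R′⊆R (F.R′⊆R r)) ; (inj₂ y) r → τ.W∩R y r }
            ; connU = τ.connU
            ; connW = connected-∪-touch σ.connW τ.connW (x , F.W⊆W′ px , x~W)
            ; connR = τ.connR ; attU = τ.attU
            ; attW = let y , r , a = τ.attW in y , r , att-⊆ inj₂ a
            ; spread = spread-mono (λ _ → [ inj₁ , inj₂ ∘ att-⊆ inj₂ ]′) τ.spread }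
        ; manyU = C.manyU
        ; manyW = λ l → let n , (r , s , a) , n∉ = C.manyW l in n , (r , s , att-⊆ inj₂ a) , n∉
        ; fewOut = C.fewOut }
    ; U⊆U′ = F.U⊆U′ ∘ U⊆ ; U′⊆ = X⊆
    ; W⊆W′ = inj₁ ; W′⊆ = [ inj₁ , (λ y → inj₂ ([ P⊆R , R′⊆R ]′ (F.W′⊆ y))) ]′
    ; R′⊆R = R′⊆R ∘ F.R′⊆R }
    where
    module F = Foot f
    module C = Core F.core
    module σ = State σ
    module τ = State C.state
    X⊆ : F.U′ ⊆ U ∪ R
    X⊆ u = [ U′⊆ , inj₂ ∘ R′⊆R ]′ (F.U′⊆ u)

  module _ (S : VSet) where

    -- By `foot-shift`, `no-foot` passes to the states of a move, so the assumption that alive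
    -- states have moves can be applied at every node of the tree.
    record Alive (U W R : VSet) : Set (lsuc ℓ) where
      field
        state : State U W R
        no-foot : ¬ Foot U W R
        U⊆S : U ⊆ S
        W⊆S : W ⊆ S
        R⊆S : R ⊆ S

    module _ (move : ∀ {U W R} → Alive U W R → Move U W R) {U₀ W₀ R₀ : VSet} (alive₀ : Alive U₀ W₀ R₀) where

      private
        record Node : Set (lsuc ℓ) where
          field
            {U W R} : VSet
            alive : Alive U W R
          open Alive alive public
          module M = Move (move alive)
          -- The region Rs 0 is given up to make the new U touch P.
          U⁺ : VSet
          U⁺ = M.U′ ∪ M.Rs 0
          U⊆U⁺ : U ⊆ U⁺
          U⊆U⁺ = inj₁ ∘ M.U⊆U′
          U⁺⊆ : U⁺ ⊆ U ∪ R
          U⁺⊆ = [ M.U′⊆ , inj₂ ∘ M.Rs⊆R ]′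
          descendState : ∀ n → State U⁺ M.P (M.Rs (suc n))
          descendState n = record
            { U∩W = [ σ.U∩W , (λ r p → State.W∩R (M.states 0) p r) ]′
            ; U∩R = [ σ.U∩R , (λ r r′ → 0≢1+n (M.disjoint r r′)) ]′
            ; W∩R = σ.W∩R
            ; connU = connected-∪-touch σ.connU (State.connR (M.states 0)) (State.attU (M.states 0))
            ; connW = σ.connW ; connR = σ.connR
            ; attU = let x , r , a = σ.attU in x , r , att-⊆ inj₁ a
            ; attW = σ.attW
            ; spread = spread-mono (λ _ → [ inj₁ ∘ att-⊆ inj₁ , inj₂ ]′) σ.spread }
            where module σ = State (M.states (suc n))
        open Node

        descend : Node → ℕ → Node
        descend v n = record { alive = record
          { state = descendState v n
          ; no-foot = no-foot v ∘ foot-shift (state v) (U⊆U⁺ v) (U⁺⊆ v) (M.P⊆R v) (M.attP v) (M.Rs⊆R v)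
          ; U⊆S = λ x → [ U⊆S v , R⊆S v ]′ (U⁺⊆ v x) ; W⊆S = R⊆S v ∘ M.P⊆R v ; R⊆S = R⊆S v ∘ M.Rs⊆R v } }

        node : List ℕ → Node
        node [] = record { alive = alive₀ }
        node (n ∷ s) = descend (node s) n

        -- `O s` is what node `s` adds to the first end. Bundling it with `P s` lets one
        -- disjointness argument also separate `t` from the sets `P`.
        O P B : List ℕ → VSet
        O s x = U⁺ (node s) x × R (node s) x
        P s = M.P (node s)
        B s = O s ∪ P s

        t : VSet
        t x = U₀ x ⊎ ∃ λ s → O s x

        U₀⊆U : ∀ s → U₀ ⊆ U (node s)
        U₀⊆U [] = id
        U₀⊆U (n ∷ s) = U⊆U⁺ (node s) ∘ U₀⊆U s

        U⊆t : ∀ s → U (node s) ⊆ t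
        U⊆t [] = inj₁
        U⊆t (n ∷ s) x = [ U⊆t s , (λ r → inj₂ (s , x , r)) ]′ (U⁺⊆ (node s) x)

        R⊆R₀ : ∀ s → R (node s) ⊆ R₀
        R⊆R₀ [] = id
        R⊆R₀ (n ∷ s) = R⊆R₀ s ∘ M.Rs⊆R (node s)

        B-disjoint : ∀ {s s′ x} → B s x → B s′ x → s ≡ s′
        B-disjoint = nested-disjoint (λ s → R (node s)) B (λ {s} → [ proj₂ , M.P⊆R (node s) ]′)
          (λ {n} {s} → M.Rs⊆R (node s))
          (λ {n} {n′} {s} r r′ → suc-injective (M.disjoint (node s) r r′))
          (λ {n} {s} → [ State.U∩R (descendState (node s) n) ∘ proj₁ , State.W∩R (descendState (node s) n) ])

        -- A vertex of `O s` lies in the first end of a child of `s`; that end is connected,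
        -- contains `U₀` and lies inside `t`.
        t-connected : Connected t
        t-connected x y = root x ◅◅ conn-sym (root y)
          where
          u₀ = State.attU (Alive.state alive₀)
          root : ∀ {x} → t x → Conn t [] x (proj₁ (proj₂ (proj₂ u₀)))
          root (inj₁ u) = conn-⊆ inj₁ (State.connU (Alive.state alive₀) u (proj₁ (proj₂ (proj₂ (proj₂ u₀)))))
          root (inj₂ (s , x , _)) = conn-⊆ (U⊆t (0 ∷ s))
            (State.connU (descendState (node s) 0) x (U₀⊆U (0 ∷ s) (proj₁ (proj₂ (proj₂ (proj₂ u₀))))))

        t∩P : ∀ {s x} → t x → ¬ P s x
        t∩P {s} (inj₁ u) p = State.U∩R (Alive.state alive₀) u (R⊆R₀ s (M.P⊆R (node s) p))
        t∩P {s′} (inj₂ (s , o)) p with B-disjoint {s} {s′} (inj₁ o) (inj₂ p)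
        ... | refl = State.U∩W (descendState (node s) 0) (proj₁ o) p

      moveTree : MinorModel G S TℵStar
      moveTree = treeMinor t P [ Alive.U⊆S alive₀ , (λ (s , _ , r) → R⊆S (node s) r) ]′
        (λ s → R⊆S (node s) ∘ M.P⊆R (node s)) t-connected (λ s → State.connW (descendState (node s) 0))
        (λ {s} {s′} p p′ → B-disjoint {s} {s′} (inj₂ p) (inj₂ p′)) (λ {s} → t∩P {s})
        (λ s → let x , r , y , p , e = State.attW (M.states (node s) 0) in
               y , p , x , inj₂ (s , inj₂ r , M.Rs⊆R (node s) r) , ∼-sym e)
        (λ n s → M.attP (node (n ∷ s)))

    footOrTree : ∀ {U W R} → State U W R → U ⊆ S → W ⊆ S → R ⊆ S → Foot U W R ⊎ MinorModel G S TℵStar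
    footOrTree {U} {W} {R} σ U⊆S W⊆S R⊆S with dec (Foot U W R)
    ... | yes f = inj₁ f
    ... | no no-foot with dec (∃ λ U → ∃ λ W → ∃ λ R → Alive U W R × ¬ Move U W R)
    ...   | no all-move = inj₂ (moveTree (λ a → dne λ ¬m → all-move (_ , _ , _ , a , ¬m))
              record { state = σ ; no-foot = no-foot ; U⊆S = U⊆S ; W⊆S = W⊆S ; R⊆S = R⊆S })
    ...   | yes (U₁ , W₁ , R₁ , alive , ¬move) = inj₂ (keepTree (Alive.state alive) keep (Alive.W⊆S alive) (Alive.R⊆S alive))
      where
      -- A `Move` or football of a substate with the same second end `W₁` is also one of the state
      -- `U₁`, `W₁`, `R₁`, which has neither; only `Keep` remains.
      keep : ∀ {U′ R′} → State U′ W₁ R′ → U₁ ⊆ U′ → U′ ⊆ U₁ ∪ R₁ → R′ ⊆ R₁ → Keep U′ W₁ R′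
      keep τ U⊆U′ U′⊆ R′⊆R with outcome τ
      ... | inj₂ (inj₁ k) = k
      ... | inj₁ f = ⊥-elim (Alive.no-foot alive record
              { core = F.core ; U⊆U′ = F.U⊆U′ ∘ U⊆U′ ; U′⊆ = λ u → [ U′⊆ , inj₂ ∘ R′⊆R ]′ (F.U′⊆ u)
              ; W⊆W′ = F.W⊆W′ ; W′⊆ = λ w → [ inj₁ , inj₂ ∘ R′⊆R ]′ (F.W′⊆ w) ; R′⊆R = R′⊆R ∘ F.R′⊆R })
        where module F = Foot f
      ... | inj₂ (inj₂ m) = ⊥-elim (¬move record
              { states = M.states ; U⊆U′ = M.U⊆U′ ∘ U⊆U′ ; U′⊆ = λ u → [ U′⊆ , inj₂ ∘ R′⊆R ]′ (M.U′⊆ u)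
              ; P⊆R = R′⊆R ∘ M.P⊆R ; attP = M.attP ; Rs⊆R = R′⊆R ∘ M.Rs⊆R ; disjoint = M.disjoint })
        where module M = Move m

-- The starting state

module Initial (lem : ∀ {a} → ExcludedMiddle a) {ℓ : Level} (G : Graph ℓ) (connected : InfEdgeConnected G)
               {u v w : V G} (u≢v : u ≢ v) (w≢u : w ≢ u) (w≢v : w ≢ v) where
  open Classical lem
  open Connectivity lem G

  S C : VSet
  S x = x ≢ u × x ≢ v
  C x = S x × Walk (StepIn G S) w x

  C-step : ∀ {x y} → C x → x ∼ y → S y → C y
  C-step (_ , walk) e s = s , walk ◅◅ step (e , s) here

  initialState : (∃ λ x → C x × u ∼ x) → (∃ λ x → C x × v ∼ x) → State ｛ u ｝ ｛ v ｝ C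
  initialState (a , ca , u~a) (b , cb , v~b) = record
    { U∩W = λ { refl refl → u≢v refl }
    ; U∩R = λ { refl ((x≢u , _) , _) → x≢u refl }
    ; W∩R = λ { refl ((_ , x≢v) , _) → x≢v refl }
    ; connU = λ { refl refl → here } ; connW = λ { refl refl → here }
    ; connR = λ (_ , walk) (_ , walk′) → conn-sym (lift root walk) ◅◅ lift root walk′
    ; attU = a , ca , u , refl , ∼-sym u~a ; attW = b , cb , v , refl , ∼-sym v~b
    -- A walk to `u` in `G` is stopped at its first step into `u` or `v`. The edges from `L` to
    -- these two vertices are deleted, so the vertex before that step is outside `L`.
    ; spread = λ c F L → exit F L c (connected _ u _ _ (F ++ cartesianProduct L (u ∷ v ∷ []))) refl }
    where
    root : C w
    root = (w≢u , w≢v) , here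
    lift : ∀ {x y} → C x → Walk (StepIn G S) x y → Conn C [] x y
    lift c here = here
    lift c (step (e , s) walk) = step (c , C-step c e s , e , avoids-[]) (lift (C-step c e s) walk)
    exit : ∀ F L {x y} → C x → Walk (StepAvoiding G (λ _ → ⊤) (F ++ cartesianProduct L (u ∷ v ∷ []))) x y → u ≡ y →
      ∃ λ z → Comp C F x z × ¬ z ∈ L × Near ｛ u ｝ ｛ v ｝ z
    exit F L ((x≢u , _) , _) here refl = ⊥-elim (x≢u refl)
    exit F L {x} c (step {y = y} (e , _ , o) walk) eq with dec (u ≡ y) | dec (v ≡ y)
    ... | yes refl | _ = x , (c , here)
        , (λ i → proj₁ o (∈-++⁺ʳ F (∈-cartesianProduct⁺ i (here refl)))) , inj₁ (u , refl , e)
    ... | no _ | yes refl = x , (c , here)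
        , (λ i → proj₁ o (∈-++⁺ʳ F (∈-cartesianProduct⁺ i (there (here refl))))) , inj₂ (v , refl , e)
    ... | no u≢y | no v≢y with C-step c e (u≢y ∘ sym , v≢y ∘ sym)
    ...   | c′ with exit F L c′ walk eq
    ...     | z , (cz , c″) , q = z , (cz , step (c , c′ , e , avoids-⊑ ∈-++⁺ˡ o) c″) , q

theorem5p13 :
  -- classical logic (the paper's ambient framework)
  (lem : ∀ {a} → ExcludedMiddle a) →
  ∀ {ℓ : Level} (G : Graph ℓ) → InfEdgeConnected G →
  (u v : V G) → u ≢ v →
  -- C is the component of G - u - v containing w
  (w : V G) → w ≢ u → w ≢ v →
  let S : V G → Set ℓ
      S x = x ≢ u × x ≢ v
      C : V G → Set ℓ
      C x = S x × Walk (StepIn G S) w x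
      D : V G → Set ℓ
      D x = C x ⊎ (x ≡ u ⊎ x ≡ v)
  in
  (∃ λ x → C x × _~_ G u x) →
  (∃ λ x → C x × _~_ G v x) →
  -- (i) G[V(C) ∪ {u,v}] has a T_ℵ₀ * t minor
  MinorModel G D TℵStar
  ⊎
  -- (ii) G[V(C) ∪ {u,v}] has a football minor connecting u and v
  (Σ (Graph ℓ) λ H → Σ (V H) λ u' → Σ (V H) λ v' →
     Football H u' v' ×
     Σ (MinorModel G D H) λ M →
       (MinorModel.B M u' u × MinorModel.B M v' v)
       ⊎ (MinorModel.B M u' v × MinorModel.B M v' u))
theorem5p13 lem G connected u v u≢v w w≢u w≢v u~C v~C
  with TreeMinors.footOrTree lem G _ (Initial.initialState lem G connected u≢v w≢u w≢v u~C v~C)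
         (inj₂ ∘ inj₁ ∘ sym) (inj₂ ∘ inj₂ ∘ sym) inj₁
... | inj₂ tree = inj₁ tree
... | inj₁ foot =
  let H , u′ , v′ , football , M , U⊆ , W⊆ =
        FootballMinor.core⇒football lem G F.core
          (λ x → [ inj₂ ∘ inj₁ ∘ sym , inj₁ ]′ (F.U′⊆ x)) (λ x → [ inj₂ ∘ inj₂ ∘ sym , inj₁ ]′ (F.W′⊆ x))
          (inj₁ ∘ F.R′⊆R)
  in inj₂ (H , u′ , v′ , football , M , inj₁ (U⊆ (F.U⊆U′ refl) , W⊆ (F.W⊆W′ refl)))
  where module F = Outcomes.Foot foot
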